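{- Let $n,k,s\in\mathbb{N}$ and $0<\varepsilon\le 1$. Suppose that $G$ is an $n$-vertex $(\varepsilon,s)$-expander and $s\ge 2^{12}\varepsilon^{ -1}k^2\log^4 n$. Then there are edge-disjoint graphs $G_1,\ldots,G_k$ such that $E(G)=\bigcup_{i\in[k]}E(G_i)$ and, for each $i\in[k]$, $G_i$ is an $\left(\frac{\varepsilon}{4},\frac{\sqrt{s\varepsilon}}{8k\log n}\right)$-expander with vertex set $V(G)$.
   Context: Graphs are finite and simple; logarithms have base two and $\log^k n=(\log n)^k$; $[k]=\{1,\ldots,k\}$. For a graph $G$ and $F\subseteq E(G)$, $G-F$ is $G$ with the edges of $F$ deleted. $N_G(U)$ is the set of vertices in $V(G)\setminus U$ with a neighbour in $U$. For real $s\ge 0$, an $n$-vertex graph $G$ is an $(\varepsilon,s)$-expander if, for every $U\subseteq V(G)$ and $F\subseteq E(G)$ with $1\le|U|\le\frac23 n$ and $|F|\le s|U|$, we have $|N_{G-F}(U)|\ge \frac{\varepsilon|U|}{\log^2 n}$. (For $n=1$ this condition is vacuous, whatever the parameters.) -}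

module Defs where

open import Data.Nat as ℕ using (ℕ; zero; suc)
import Data.Nat.Properties as ℕ
open import Data.Nat.Solver renaming (module +-*-Solver to ℕ-Solver)
open import Data.Nat.Coprimality using (1-coprimeTo) renaming (sym to coprime-sym)
open import Data.Integer as ℤ using (-[1+_])
import Data.Integer.Properties as ℤ
open import Data.Rational as ℚ using (ℚ; mkℚ; *≤*; *<*; 0ℚ; 1ℚ; ½; ↥_; ↧ₙ_; _+_; _*_; _-_; _<_; _≤_)
import Data.Rational.Properties as ℚ
import Data.Rational.Unnormalised as ℚᵘ
import Data.Rational.Unnormalised.Properties as ℚᵘ
open import Data.Rational.Solver using (module +-*-Solver)
open import Data.Fin as Fin using (Fin)
import Data.Fin.Properties as Fin
open import Data.Fin.Subset using (Subset; ∣_∣)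
open import Data.Fin.Subset.Properties using (_∈?_)
open import Data.List using (List; length; filter; allFin; cartesianProduct)
open import Data.Vec using (tabulate)
open import Data.Product using (∃; ∃-syntax; _×_; _,_; proj₁; proj₂)
open import Data.Sum using (_⊎_; inj₁; inj₂; [_,_]′)
open import Data.Empty using (⊥-elim)
open import Function using (_∘_; _⇔_)
open import Level using (0ℓ)
open import Relation.Binary using (Rel; Decidable; Symmetric; Irreflexive; tri<; tri≈; tri>)
open import Relation.Binary.PropositionalEquality
open import Relation.Nullary using (¬_; Dec; yes; no; does; contradiction; ¬?; _×-dec_)

module RationalLemmas where
  open +-*-Solver using (solve; _:=_; _:+_; _:*_; _:-_; :-_)

  ι : ℕ → ℚ
  ι m = ℤ.+ m ℚ./ 1

  ι-mk : ∀ m → ι m ≡ mkℚ (ℤ.+ m) 0 (coprime-sym (1-coprimeTo m))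
  ι-mk m = ℚ.↥p/↧p≡p (mkℚ (ℤ.+ m) 0 (coprime-sym (1-coprimeTo m)))

  ι-suc : ∀ m → ι (suc m) ≡ 1ℚ + ι m
  ι-suc m rewrite ι-mk (suc m) | ι-mk m = ℚ.toℚᵘ-injective (ℚᵘ.≃-sym
    (ℚᵘ.≃-trans (ℚ.toℚᵘ-homo-+ 1ℚ (mkℚ (ℤ.+ m) 0 (coprime-sym (1-coprimeTo m))))
      (ℚᵘ.*≡* (cong (λ i → i ℤ.* ℤ.+ 1) (cong (λ i → ℤ.+ 1 ℤ.+ i) (ℤ.*-identityʳ (ℤ.+ m)))))))

  0≤ι : ∀ m → 0ℚ ≤ ι m
  0≤ι m rewrite ι-mk m = *≤* (ℤ.≤-trans (ℤ.≤-reflexive (ℤ.*-zeroˡ (ℤ.+ 1))) (ℤ.≤-trans (ℤ.+≤+ ℕ.z≤n) (ℤ.≤-reflexive (sym (ℤ.*-identityʳ (ℤ.+ m))))))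

  archimedean : ∀ p → ∃[ m ] p ≤ ι m
  archimedean p@(mkℚ n d _) = ℤ.∣ n ∣ , subst (p ≤_) (sym (ι-mk ℤ.∣ n ∣)) (*≤* (bound n))
    where
    bound : ∀ n → n ℤ.* ℤ.+ 1 ℤ.≤ ℤ.+ ℤ.∣ n ∣ ℤ.* ℤ.+ suc d
    bound (ℤ.+ n) rewrite sym (ℤ.pos-* n 1) | sym (ℤ.pos-* n (suc d)) = ℤ.+≤+ (ℕ.*-monoʳ-≤ n (ℕ.s≤s ℕ.z≤n))
    bound -[1+ n ] = ℤ.-≤+

  0<-* : ∀ {p q} → 0ℚ < p → 0ℚ < q → 0ℚ < p * q
  0<-* {p} {q} 0<p 0<q = subst (_< p * q) (ℚ.*-zeroʳ p) (ℚ.*-monoʳ-<-pos p {{ℚ.positive 0<p}} 0<q)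

  *-monoˡ-< : ∀ {r p q} → 0ℚ < r → p < q → p * r < q * r
  *-monoˡ-< {r} 0<r = ℚ.*-monoˡ-<-pos r {{ℚ.positive 0<r}}

  *-mono-≤ : ∀ {a b c d} → 0ℚ ≤ b → 0ℚ ≤ c → a ≤ c → b ≤ d → a * b ≤ c * d
  *-mono-≤ {a} {b} {c} {d} 0≤b 0≤c a≤c b≤d = ℚ.≤-trans
    (ℚ.*-monoʳ-≤-nonNeg b {{ℚ.nonNegative 0≤b}} a≤c)
    (ℚ.*-monoˡ-≤-nonNeg c {{ℚ.nonNegative 0≤c}} b≤d)

  0≤-* : ∀ {a b} → 0ℚ ≤ a → 0ℚ ≤ b → 0ℚ ≤ a * b
  0≤-* {a} {b} 0≤a 0≤b = subst (_≤ a * b) (ℚ.*-zeroˡ b) (*-mono-≤ 0≤b 0≤a 0≤a ℚ.≤-refl)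

  0<-+ : ∀ {p q} → 0ℚ ≤ p → 0ℚ < q → 0ℚ < p + q
  0<-+ = ℚ.+-mono-≤-<

  0≤-+ : ∀ {p q} → 0ℚ ≤ p → 0ℚ ≤ q → 0ℚ ≤ p + q
  0≤-+ = ℚ.+-mono-≤

  0<1 : 0ℚ < 1ℚ
  0<1 = ℚ.positive⁻¹ 1ℚ

  <-diff : ∀ {p q} → p < q → 0ℚ < q - p
  <-diff {p} {q} p<q = subst (_< q - p) (ℚ.+-inverseʳ p) (ℚ.+-monoˡ-< (ℚ.- p) p<q)

  p<p+q : ∀ {p q} → 0ℚ < q → p < p + q
  p<p+q {p} {q} 0<q = subst (_< p + q) (ℚ.+-identityʳ p) (ℚ.+-monoʳ-< p 0<q)

  quotient : ∀ p {q} → 0ℚ < q → ∃[ r ] r * q ≡ p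
  quotient p {q} 0<q = p * ℚ.1/ q , trans (ℚ.*-assoc p (ℚ.1/ q) q)
    (trans (cong (p *_) (ℚ.*-inverseˡ q)) (ℚ.*-identityʳ p))
    where instance _ = ℚ.>-nonZero 0<q

  quotient-pos : ∀ {p q r} → 0ℚ < p → 0ℚ < q → r * q ≡ p → 0ℚ < r
  quotient-pos {p} {q} {r} 0<p 0<q eq =
    ℚ.*-cancelʳ-<-nonNeg q {{ℚ.nonNegative (ℚ.<⇒≤ 0<q)}}
      (subst₂ _<_ (sym (ℚ.*-zeroˡ q)) (sym eq) 0<p)

  halve : ∀ {δ} → 0ℚ < δ → ∃[ η ] 0ℚ < η × (∀ a → (a + η) + η ≡ a + δ)
  halve {δ} 0<δ = ½ * δ , 0<-* (ℚ.positive⁻¹ ½) 0<δ , λ a → trans (ℚ.+-assoc a (½ * δ) (½ * δ))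
    (cong (λ z → a + z) (trans (sym (ℚ.*-distribʳ-+ δ ½ ½)) (ℚ.*-identityˡ δ)))

  steps : ∀ t {η} → 0ℚ < η → ∃[ m ] t ≤ ℚ.- η + ι m * η
  steps t {η} 0<η =
    let (r , rη≡) = quotient (t + η) 0<η
        (m , r≤m) = archimedean r
    in m , subst (_≤ ℚ.- η + ι m * η)
      (trans (cong (λ z → ℚ.- η + z) rη≡) (solve 2 (λ t e → (:- e) :+ (t :+ e) := t) refl t η))
      (ℚ.+-monoʳ-≤ (ℚ.- η) (ℚ.*-monoʳ-≤-nonNeg η {{ℚ.nonNegative (ℚ.<⇒≤ 0<η)}} r≤m))

  walk-zero : ∀ a η → a + ι 0 * η ≡ a
  walk-zero a η = trans (cong (λ z → a + z) (ℚ.*-zeroˡ η)) (ℚ.+-identityʳ a)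

  walk-suc : ∀ m a η → a + ι (suc m) * η ≡ (a + η) + ι m * η
  walk-suc m a η = trans (cong (λ i → a + i * η) (ι-suc m))
    (trans (cong (λ z → a + z) (trans (ℚ.*-distribʳ-+ η 1ℚ (ι m)) (cong (_+ ι m * η) (ℚ.*-identityˡ η))))
      (sym (ℚ.+-assoc a η (ι m * η))))

  +-cancel- : ∀ p q → p + (q - p) ≡ q
  +-cancel- = solve 2 (λ p q → p :+ (q :- p) := q) refl

  0∨pos : ∀ p → p < 0ℚ ⊎ 0ℚ ≤ p
  0∨pos p with p ℚ.<? 0ℚ
  ... | yes p<0 = inj₁ p<0
  ... | no  p≮0 = inj₂ (ℚ.≮⇒≥ p≮0)

  -- δ = min(1, e/S)
  shrink : ∀ {e S} → 0ℚ < e → 0ℚ < S → ∃[ δ ] 0ℚ < δ × δ ≤ 1ℚ × δ * S ≤ e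
  shrink {e} {S} 0<e 0<S = pick (quotient e 0<S)
    where
    pick : ∃[ r ] r * S ≡ e → ∃[ δ ] 0ℚ < δ × δ ≤ 1ℚ × δ * S ≤ e
    pick (r , rS≡e) with quotient-pos 0<e 0<S rS≡e | ℚ.≤-total r 1ℚ
    ... | 0<r | inj₁ r≤1 = r , 0<r , r≤1 , ℚ.≤-reflexive rS≡e
    ... | 0<r | inj₂ 1≤r = 1ℚ , 0<1 , ℚ.≤-refl ,
      ℚ.≤-trans (*-mono-≤ (ℚ.<⇒≤ 0<S) (ℚ.<⇒≤ 0<r) 1≤r ℚ.≤-refl) (ℚ.≤-reflexive rS≡e)

  product-bound : ∀ {a b A B X Y δ e} → a ≤ A → b ≤ B → 0ℚ ≤ A → A ≤ X → B ≤ Y → 0ℚ ≤ b + δ →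
                  0ℚ < δ → δ ≤ 1ℚ → δ * ((X + Y) + 1ℚ) ≤ e → (a + δ) * (b + δ) ≤ A * B + e
  product-bound {A = A} {B} {δ = δ} a≤A b≤B 0≤A A≤X B≤Y 0≤b+δ 0<δ δ≤1 δS≤e = ℚ.≤-trans
    (*-mono-≤ 0≤b+δ (0≤-+ 0≤A (ℚ.<⇒≤ 0<δ)) (ℚ.+-monoˡ-≤ δ a≤A) (ℚ.+-monoˡ-≤ δ b≤B))
    (ℚ.≤-trans (ℚ.≤-reflexive
      (solve 3 (λ a b d → (a :+ d) :* (b :+ d) := a :* b :+ d :* ((a :+ b) :+ d)) refl A B δ))
      (ℚ.+-monoʳ-≤ (A * B) (ℚ.≤-trans
        (ℚ.*-monoˡ-≤-nonNeg δ {{ℚ.nonNegative (ℚ.<⇒≤ 0<δ)}} (ℚ.+-mono-≤ (ℚ.+-mono-≤ A≤X B≤Y) δ≤1)) δS≤e)))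

  square-bound : ∀ {q δ t} → 0ℚ < δ → δ ≤ 1ℚ → δ * ((q + q) + 1ℚ) ≤ t - q * q → (q + δ) * (q + δ) ≤ t
  square-bound {q} {δ} {t} 0<δ δ≤1 δS≤ = ℚ.≤-trans (ℚ.≤-reflexive
      (solve 2 (λ q d → (q :+ d) :* (q :+ d) := q :* q :+ d :* ((q :+ q) :+ d)) refl q δ))
    (ℚ.≤-trans (ℚ.+-monoʳ-≤ (q * q) (ℚ.≤-trans
      (ℚ.*-monoˡ-≤-nonNeg δ {{ℚ.nonNegative (ℚ.<⇒≤ 0<δ)}} (ℚ.+-monoʳ-≤ (q + q) δ≤1)) δS≤))
    (ℚ.≤-reflexive (+-cancel- (q * q) t)))

  ratio-bound : ∀ {p q a b b₀ δ} → 0ℚ ≤ p → p < q → 0ℚ < δ → δ * (p + 1ℚ) ≡ (q - p) * b₀ →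
                a ≤ b → b₀ ≤ b → p * (a + δ) < q * b
  ratio-bound {p} {q} {a} {b} {b₀} {δ} 0≤p p<q 0<δ eq a≤b b₀≤b = ℚ.≤-<-trans
    (ℚ.*-monoˡ-≤-nonNeg p {{ℚ.nonNegative 0≤p}} (ℚ.+-monoˡ-≤ δ a≤b))
    (ℚ.<-≤-trans (subst (_< p * b + (q - p) * b₀) (sym (ℚ.*-distribˡ-+ p b δ)) (ℚ.+-monoʳ-< (p * b) pδ<))
    (ℚ.≤-trans (ℚ.+-monoʳ-≤ (p * b)
      (ℚ.*-monoˡ-≤-nonNeg (q - p) {{ℚ.nonNegative (ℚ.<⇒≤ (<-diff p<q))}} b₀≤b))
    (ℚ.≤-reflexive (solve 3 (λ p q b → p :* b :+ (q :- p) :* b := q :* b) refl p q b))))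
    where
    pδ< : p * δ < (q - p) * b₀
    pδ< = subst (p * δ <_)
      (trans (sym (trans (ℚ.*-distribˡ-+ δ p 1ℚ) (cong₂ _+_ (ℚ.*-comm δ p) (ℚ.*-identityʳ δ)))) eq) (p<p+q 0<δ)

open RationalLemmas

-- Located Dedekind cuts containing every negative rational, given by
-- their lower halves.
record ℝ≥0 : Set₁ where
  field
    -- The rational q is strictly less than the real number.
    Below    : ℚ → Set
    negative : ∀ {q} → q < 0ℚ → Below q
    bounded  : ∃[ q ] ¬ Below q
    lower    : ∀ {p q} → p < q → Below q → Below p
    open′    : ∀ {q} → Below q → ∃[ r ] q < r × Below r
    -- Holds for every cut in classical mathematics.
    located  : ∀ {p q} → p < q → Below p ⊎ ¬ Below q

open ℝ≥0 using (Below)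

infix 4 _≤ᴿ_

_≤ᴿ_ : ℝ≥0 → ℝ≥0 → Set
x ≤ᴿ y = ∀ q → Below x q → Below y q

record Positive (x : ℝ≥0) : Set where
  constructor positive
  field 0<x : Below x 0ℚ

fromℕ : ℕ → ℝ≥0
fromℕ m = record
  { Below    = _< ι m
  ; negative = λ q<0 → ℚ.<-≤-trans q<0 (0≤ι m)
  ; bounded  = ι m , ℚ.<-irrefl refl
  ; lower    = ℚ.<-trans
  ; open′    = ℚ.<-dense
  ; located  = λ {p} {q} p<q → loc p<q (p ℚ.<? ι m)
  }
  where
  loc : ∀ {p q} → p < q → Dec (p < ι m) → p < ι m ⊎ ¬ q < ι m
  loc p<q (yes p<m) = inj₁ p<m
  loc p<q (no  p≮m) = inj₂ (λ q<m → p≮m (ℚ.<-trans p<q q<m))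

module Cut (x : ℝ≥0) where
  open ℝ≥0 x public renaming (Below to B)

  lower≤ : ∀ {p q} → p ≤ q → B q → B p
  lower≤ {p} {q} p≤q bq with ℚ.<-cmp p q
  ... | tri< p<q _ _ = lower p<q bq
  ... | tri≈ _ refl _ = bq
  ... | tri> _ _ q<p = ⊥-elim (ℚ.<-irrefl refl (ℚ.<-≤-trans q<p p≤q))

  separate : ∀ {a c} → B a → ¬ B c → a < c
  separate {a} {c} ba ¬bc with a ℚ.<? c
  ... | yes a<c = a<c
  ... | no  a≮c = ⊥-elim (¬bc (lower≤ (ℚ.≮⇒≥ a≮c) ba))

  above≥0 : ∀ {c} → ¬ B c → 0ℚ ≤ c
  above≥0 {c} ¬bc with 0∨pos c
  ... | inj₁ c<0 = ⊥-elim (¬bc (negative c<0))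
  ... | inj₂ 0≤c = 0≤c

  walk : ∀ {η} → 0ℚ < η → ∀ m a → B a → ¬ B (a + ι m * η) → ∃[ a ] B a × ¬ B ((a + η) + η)
  walk {η} 0<η zero a ba ¬b = contradiction ba (subst (¬_ ∘ B) (walk-zero a η) ¬b)
  walk {η} 0<η (suc m) a ba ¬b with located (p<p+q {a + η} 0<η)
  ... | inj₂ ¬b′ = a , ba , ¬b′
  ... | inj₁ b′  = walk 0<η m (a + η) b′ (subst (¬_ ∘ B) (walk-suc m a η) ¬b)

  approx : ∀ {δ} → 0ℚ < δ → ∃[ a ] B a × ¬ B (a + δ)
  approx 0<δ =
    let (η , 0<η , η+η) = halve 0<δ
        (top , ¬top) = bounded
        (m , top≤) = steps top 0<η
        (a , ba , ¬b) = walk 0<η m (ℚ.- η) (negative (ℚ.neg-antimono-< 0<η)) (λ b → ¬top (lower≤ top≤ b))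
    in a , ba , subst (¬_ ∘ B) (η+η a) ¬b

infixl 7 _*ᴿ_

_*ᴿ_ : ℝ≥0 → ℝ≥0 → ℝ≥0
x *ᴿ y = record
  { Below    = B
  ; negative = inj₁
  ; bounded  = X.above *ᵁ Y.above
  ; lower    = λ { p<q (inj₁ q<0) → inj₁ (ℚ.<-trans p<q q<0)
                 ; p<q (inj₂ (a , b , 0≤a , 0≤b , a<x , b<y , q<ab)) →
                     inj₂ (a , b , 0≤a , 0≤b , a<x , b<y , ℚ.<-trans p<q q<ab) }
  ; open′    = λ { (inj₁ q<0) → let (r , q<r , r<0) = ℚ.<-dense q<0 in r , q<r , inj₁ r<0
                 ; (inj₂ (a , b , 0≤a , 0≤b , a<x , b<y , q<ab)) →
                     let (r , q<r , r<ab) = ℚ.<-dense q<ab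
                     in r , q<r , inj₂ (a , b , 0≤a , 0≤b , a<x , b<y , r<ab) }
  ; located  = loc
  }
  where
  module X where
    open Cut x public
    above = bounded
  module Y where
    open Cut y public
    above = bounded

  B : ℚ → Set
  B q = q < 0ℚ ⊎ ∃[ a ] ∃[ b ] 0ℚ ≤ a × 0ℚ ≤ b × Below x a × Below y b × q < a * b

  ¬B : ∀ {c d q} → ¬ X.B c → ¬ Y.B d → c * d ≤ q → ¬ B q
  ¬B ¬c ¬d cd≤q (inj₁ q<0) =
    ℚ.<-irrefl refl (ℚ.<-≤-trans q<0 (ℚ.≤-trans (0≤-* (X.above≥0 ¬c) (Y.above≥0 ¬d)) cd≤q))
  ¬B ¬c ¬d cd≤q (inj₂ (a , b , 0≤a , 0≤b , a<x , b<y , q<ab)) =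
    ℚ.<-irrefl refl (ℚ.<-≤-trans q<ab (ℚ.≤-trans
      (*-mono-≤ 0≤b (X.above≥0 ¬c) (ℚ.<⇒≤ (X.separate a<x ¬c)) (ℚ.<⇒≤ (Y.separate b<y ¬d))) cd≤q))

  _*ᵁ_ : ∃[ c ] ¬ X.B c → ∃[ d ] ¬ Y.B d → ∃[ q ] ¬ B q
  (c , ¬c) *ᵁ (d , ¬d) = c * d , ¬B ¬c ¬d ℚ.≤-refl

  below⁺ : ∀ (z : ℝ≥0) {c} r → 0ℚ < (c ℚ.⊔ 0ℚ) * r → Below z c → Below z (c ℚ.⊔ 0ℚ)
  below⁺ z {c} r 0<cr bc with ℚ.≤-total c 0ℚ
  ... | inj₁ c≤0 = ⊥-elim (ℚ.<-irrefl (sym (trans (cong (_* r) (ℚ.p≤q⇒p⊔q≡q c≤0)) (ℚ.*-zeroˡ r))) 0<cr)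
  ... | inj₂ 0≤c = subst (Below z) (sym (ℚ.p≥q⇒p⊔q≡p 0≤c)) bc

  decide : ∀ {p q a b δ} → 0ℚ ≤ p → Below x a → Below y b → ¬ Below x (a + δ) → ¬ Below y (b + δ) →
           (a + δ) * (b + δ) ≤ (a ℚ.⊔ 0ℚ) * (b ℚ.⊔ 0ℚ) + (q - p) → B p ⊎ ¬ B q
  decide {p} {q} {a} {b} 0≤p a<x b<y ¬c ¬d cd≤ with p ℚ.<? (a ℚ.⊔ 0ℚ) * (b ℚ.⊔ 0ℚ)
  ... | yes p<ab = inj₁ (inj₂ (a ℚ.⊔ 0ℚ , b ℚ.⊔ 0ℚ , ℚ.p≤q⊔p a 0ℚ , ℚ.p≤q⊔p b 0ℚ
      , below⁺ x (b ℚ.⊔ 0ℚ) (ℚ.≤-<-trans 0≤p p<ab) a<x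
      , below⁺ y (a ℚ.⊔ 0ℚ) (subst (0ℚ <_) (ℚ.*-comm (a ℚ.⊔ 0ℚ) (b ℚ.⊔ 0ℚ)) (ℚ.≤-<-trans 0≤p p<ab)) b<y
      , p<ab))
  ... | no  p≮ab = inj₂ (¬B ¬c ¬d (ℚ.≤-trans cd≤
      (ℚ.≤-trans (ℚ.+-monoˡ-≤ (q - p) (ℚ.≮⇒≥ p≮ab)) (ℚ.≤-reflexive (+-cancel- p q)))))

  loc : ∀ {p q} → p < q → B p ⊎ ¬ B q
  loc {p} {q} p<q with 0∨pos p
  ... | inj₁ p<0 = inj₁ (inj₁ p<0)
  ... | inj₂ 0≤p =
    let (_ , ¬cx) = X.bounded
        (_ , ¬cy) = Y.bounded
        0≤cx = X.above≥0 ¬cx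
        0≤cy = Y.above≥0 ¬cy
        (_ , 0<δ , δ≤1 , δS≤) = shrink (<-diff p<q) (0<-+ (0≤-+ 0≤cx 0≤cy) 0<1)
        (a , a<x , ¬c) = X.approx 0<δ
        (b , b<y , ¬d) = Y.approx 0<δ
    in decide {p} {q} 0≤p a<x b<y ¬c ¬d (product-bound
         (ℚ.p≤p⊔q a 0ℚ) (ℚ.p≤p⊔q b 0ℚ) (ℚ.p≤q⊔p a 0ℚ)
         (ℚ.⊔-lub (ℚ.<⇒≤ (X.separate a<x ¬cx)) 0≤cx)
         (ℚ.⊔-lub (ℚ.<⇒≤ (Y.separate b<y ¬cy)) 0≤cy)
         (Y.above≥0 ¬d) 0<δ δ≤1 δS≤)

infixr 8 _^ᴿ_

_^ᴿ_ : ℝ≥0 → ℕ → ℝ≥0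
x ^ᴿ zero  = fromℕ 1
x ^ᴿ suc m = x *ᴿ x ^ᴿ m

infixl 7 _/ᴿ_

-- q < x /ᴿ y exactly when q * r < x for some rational r ≥ y.
_/ᴿ_ : (x y : ℝ≥0) {{_ : Positive y}} → ℝ≥0
_/ᴿ_ x y {{positive 0<y}} = record
  { Below    = B
  ; negative = λ {q} q<0 → let (r , ¬r) = Y.bounded in r , ¬r ,
      X.negative (subst (q * r <_) (ℚ.*-zeroˡ r) (*-monoˡ-< (r>0 ¬r) q<0))
  ; bounded  = bnd
  ; lower    = λ { p<q (r , ¬r , qr<x) → r , ¬r , X.lower (*-monoˡ-< (r>0 ¬r) p<q) qr<x }
  ; open′    = opn
  ; located  = loc
  }
  where
  module X = Cut x
  module Y = Cut y

  B : ℚ → Set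
  B q = ∃[ r ] ¬ Below y r × Below x (q * r)

  r>0 : ∀ {r} → ¬ Below y r → 0ℚ < r
  r>0 = Y.separate 0<y

  b₀ = proj₁ (Y.open′ 0<y)
  0<b₀ = proj₁ (proj₂ (Y.open′ 0<y))
  b₀<y = proj₂ (proj₂ (Y.open′ 0<y))

  ¬B : ∀ {q b} → 0ℚ ≤ q → Below y b → ¬ Below x (q * b) → ¬ B q
  ¬B {q} {b} 0≤q b<y ¬qb (r , ¬r , qr<x) = ¬qb (X.lower≤
    (ℚ.*-monoˡ-≤-nonNeg q {{ℚ.nonNegative 0≤q}} (ℚ.<⇒≤ (Y.separate b<y ¬r))) qr<x)

  bnd : ∃[ q ] ¬ B q
  bnd = let (c , ¬c) = X.bounded
            (q , qb≡c) = quotient (c + 1ℚ) 0<b₀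
            0<c+1 = 0<-+ (X.above≥0 ¬c) 0<1
        in q , ¬B (ℚ.<⇒≤ (quotient-pos {r = q} 0<c+1 0<b₀ qb≡c)) b₀<y
             (λ bel → ¬c (X.lower (subst (c <_) (sym qb≡c) (p<p+q 0<1)) bel))

  opn : ∀ {q} → B q → ∃[ s ] q < s × B s
  opn {q} (r , ¬r , qr<x) =
    let (t , qr<t , t<x) = X.open′ qr<x
        (s , sr≡t) = quotient t (r>0 ¬r)
    in s , ℚ.*-cancelʳ-<-nonNeg r {{ℚ.nonNegative (ℚ.<⇒≤ (r>0 ¬r))}} (subst (q * r <_) (sym sr≡t) qr<t)
         , r , ¬r , subst (Below x) (sym sr≡t) t<x

  pick : ∀ {a} → Below y a → ∃[ b ] Below y b × a ≤ b × b₀ ≤ b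
  pick {a} a<y with ℚ.≤-total a b₀
  ... | inj₁ a≤b₀ = b₀ , b₀<y , a≤b₀ , ℚ.≤-refl
  ... | inj₂ b₀≤a = a , a<y , ℚ.≤-refl , b₀≤a

  answer : ∀ {p q b c} → 0ℚ ≤ p → p < q → Below y b → ¬ Below y c → p * c < q * b → B p ⊎ ¬ B q
  answer {c = c} 0≤p p<q b<y ¬c pc<qb with X.located pc<qb
  ... | inj₁ pc<x = inj₁ (c , ¬c , pc<x)
  ... | inj₂ ¬qb  = inj₂ (¬B (ℚ.≤-trans 0≤p (ℚ.<⇒≤ p<q)) b<y ¬qb)

  loc : ∀ {p q} → p < q → B p ⊎ ¬ B q
  loc {p} {q} p<q with 0∨pos p
  ... | inj₁ p<0 = let (r , ¬r) = Y.bounded in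
    inj₁ (r , ¬r , X.negative (subst (p * r <_) (ℚ.*-zeroˡ r) (*-monoˡ-< (r>0 ¬r) p<0)))
  ... | inj₂ 0≤p =
    let 0<num = 0<-* (<-diff p<q) 0<b₀
        0<p+1 = 0<-+ 0≤p 0<1
        (δ , eq) = quotient ((q - p) * b₀) 0<p+1
        0<δ = quotient-pos {r = δ} 0<num 0<p+1 eq
        (a , a<y , ¬c) = Y.approx 0<δ
        (b , b<y , a≤b , b₀≤b) = pick a<y
    in answer 0≤p p<q b<y ¬c (ratio-bound {p} {q} 0≤p p<q 0<δ eq a≤b b₀≤b)

√_ : ℝ≥0 → ℝ≥0
√ x = record
  { Below    = B
  ; negative = inj₁
  ; bounded  = let (c , ¬c) = X.bounded in c + 1ℚ , bnd c ¬c
  ; lower    = low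
  ; open′    = opn
  ; located  = loc
  }
  where
  module X = Cut x

  B : ℚ → Set
  B q = q < 0ℚ ⊎ Below x (q * q)

  sq-mono : ∀ {p q} → 0ℚ ≤ p → p < q → p * p < q * q
  sq-mono {p} {q} 0≤p p<q = ℚ.≤-<-trans
    (ℚ.*-monoˡ-≤-nonNeg p {{ℚ.nonNegative 0≤p}} (ℚ.<⇒≤ p<q))
    (*-monoˡ-< (ℚ.≤-<-trans 0≤p p<q) p<q)

  bnd : ∀ c → ¬ Below x c → ¬ B (c + 1ℚ)
  bnd c ¬c (inj₁ c+1<0) = ℚ.<-asym c+1<0 (0<-+ (X.above≥0 ¬c) 0<1)
  bnd c ¬c (inj₂ b) = ¬c (X.lower≤ c≤ b)
    where
    0≤c = X.above≥0 ¬c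
    c≤ : c ≤ (c + 1ℚ) * (c + 1ℚ)
    c≤ = ℚ.≤-trans (ℚ.<⇒≤ (p<p+q 0<1)) (ℚ.≤-trans (ℚ.≤-reflexive (sym (ℚ.*-identityˡ (c + 1ℚ))))
      (ℚ.*-monoʳ-≤-nonNeg (c + 1ℚ) {{ℚ.nonNegative (ℚ.<⇒≤ (0<-+ 0≤c 0<1))}}
        (subst (_≤ c + 1ℚ) (ℚ.+-identityˡ 1ℚ) (ℚ.+-monoˡ-≤ 1ℚ 0≤c))))

  low : ∀ {p q} → p < q → B q → B p
  low p<q (inj₁ q<0) = inj₁ (ℚ.<-trans p<q q<0)
  low {p} p<q (inj₂ b) with 0∨pos p
  ... | inj₁ p<0 = inj₁ p<0
  ... | inj₂ 0≤p = inj₂ (X.lower (sq-mono 0≤p p<q) b)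

  loc : ∀ {p q} → p < q → B p ⊎ ¬ B q
  loc {p} {q} p<q with 0∨pos p
  ... | inj₁ p<0 = inj₁ (inj₁ p<0)
  ... | inj₂ 0≤p with X.located (sq-mono 0≤p p<q)
  ...   | inj₁ b  = inj₁ (inj₂ b)
  ...   | inj₂ ¬b = inj₂ λ { (inj₁ q<0) → ℚ.<-asym q<0 (ℚ.≤-<-trans 0≤p p<q) ; (inj₂ b) → ¬b b }

  opn : ∀ {q} → B q → ∃[ r ] q < r × B r
  opn (inj₁ q<0) = let (r , q<r , r<0) = ℚ.<-dense q<0 in r , q<r , inj₁ r<0
  opn {q} (inj₂ b) with 0∨pos q
  ... | inj₁ q<0 = let (r , q<r , r<0) = ℚ.<-dense q<0 in r , q<r , inj₁ r<0
  ... | inj₂ 0≤q =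
    let (t , q²<t , t<x) = X.open′ b
        (δ , 0<δ , δ≤1 , δS≤) = shrink (<-diff q²<t) (0<-+ (0≤-+ 0≤q 0≤q) 0<1)
    in q + δ , p<p+q 0<δ , inj₂ (X.lower≤ (square-bound {q} {δ} {t} 0<δ δ≤1 δS≤) t<x)

module LogLemmas (n : ℕ) where
  scale : ∀ a b c d .{{_ : ℕ.NonZero d}} → 2 ℕ.^ a ℕ.< n ℕ.^ b → c ℕ.* b ℕ.≤ a ℕ.* d → 2 ℕ.^ c ℕ.< n ℕ.^ d
  scale a b c d 2ᵃ<nᵇ cb≤ad = ℕ.≰⇒> λ nᵈ≤2ᶜ → ℕ.<-irrefl refl (begin-strict
    n ℕ.^ (d ℕ.* b)      ≡⟨ ℕ.^-*-assoc n d b ⟨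
    (n ℕ.^ d) ℕ.^ b      ≤⟨ ℕ.^-monoˡ-≤ b nᵈ≤2ᶜ ⟩
    (2 ℕ.^ c) ℕ.^ b      ≡⟨ ℕ.^-*-assoc 2 c b ⟩
    2 ℕ.^ (c ℕ.* b)      ≤⟨ ℕ.^-monoʳ-≤ 2 cb≤ad ⟩
    2 ℕ.^ (a ℕ.* d)      ≡⟨ ℕ.^-*-assoc 2 a d ⟨
    (2 ℕ.^ a) ℕ.^ d      <⟨ ℕ.^-monoˡ-< d 2ᵃ<nᵇ ⟩
    (n ℕ.^ b) ℕ.^ d      ≡⟨ ℕ.^-*-assoc n b d ⟩
    n ℕ.^ (b ℕ.* d)      ≡⟨ cong (n ℕ.^_) (ℕ.*-comm b d) ⟩
    n ℕ.^ (d ℕ.* b)      ∎)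
    where open ℕ.≤-Reasoning

  bernoulli : ∀ x m → x ℕ.^ m ℕ.* (x ℕ.+ m) ℕ.≤ suc x ℕ.^ m ℕ.* x
  bernoulli x zero    = ℕ.≤-reflexive (cong (ℕ._+ 0) (ℕ.+-identityʳ x))
  bernoulli x (suc m) = begin
    x ℕ.* x ℕ.^ m ℕ.* (x ℕ.+ suc m)
      ≡⟨ N.solve 3 (λ x y m → x N.:* y N.:* (x N.:+ (N.con 1 N.:+ m)) N.:=
                     x N.:* (y N.:* (x N.:+ m)) N.:+ y N.:* x) refl x (x ℕ.^ m) m ⟩
    x ℕ.* (x ℕ.^ m ℕ.* (x ℕ.+ m)) ℕ.+ x ℕ.^ m ℕ.* x
      ≤⟨ ℕ.+-mono-≤ (ℕ.*-monoʳ-≤ x (bernoulli x m)) (ℕ.*-monoˡ-≤ x (ℕ.^-monoˡ-≤ m (ℕ.n≤1+n x))) ⟩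
    x ℕ.* (suc x ℕ.^ m ℕ.* x) ℕ.+ suc x ℕ.^ m ℕ.* x
      ≡⟨ N.solve 2 (λ x y → x N.:* (y N.:* x) N.:+ y N.:* x N.:=
                     (N.con 1 N.:+ x) N.:* y N.:* x) refl x (suc x ℕ.^ m) ⟩
    suc x ℕ.* suc x ℕ.^ m ℕ.* x ∎
    where
    open ℕ.≤-Reasoning
    module N = ℕ-Solver

  double< : ∀ x → 0 ℕ.< x → 2 ℕ.* x ℕ.^ suc x ℕ.< suc x ℕ.^ suc x
  double< x 0<x = ℕ.*-cancelʳ-< x _ _ (begin-strict
    2 ℕ.* x ℕ.^ suc x ℕ.* x          ≡⟨ N.solve 2 (λ x y → N.con 2 N.:* y N.:* x N.:= y N.:* (x N.:+ x)) refl x (x ℕ.^ suc x) ⟩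
    x ℕ.^ suc x ℕ.* (x ℕ.+ x)        <⟨ ℕ.*-monoʳ-< (x ℕ.^ suc x) {{ℕ.m^n≢0 x (suc x) {{ℕ.>-nonZero 0<x}}}} (ℕ.+-monoʳ-< x (ℕ.n<1+n x)) ⟩
    x ℕ.^ suc x ℕ.* (x ℕ.+ suc x)    ≤⟨ bernoulli x (suc x) ⟩
    suc x ℕ.^ suc x ℕ.* x            ∎)
    where
    open ℕ.≤-Reasoning
    module N = ℕ-Solver

  improve : ∀ a b → 2 ℕ.^ a ℕ.< n ℕ.^ b →
            2 ℕ.^ suc (a ℕ.* suc (2 ℕ.^ a)) ℕ.< n ℕ.^ (b ℕ.* suc (2 ℕ.^ a))
  improve a b 2ᵃ<nᵇ = begin-strict
    2 ℕ.* 2 ℕ.^ (a ℕ.* suc A)   ≡⟨ cong (2 ℕ.*_) (ℕ.^-*-assoc 2 a (suc A)) ⟨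
    2 ℕ.* A ℕ.^ suc A           <⟨ double< A (ℕ.m^n>0 2 a) ⟩
    suc A ℕ.^ suc A             ≤⟨ ℕ.^-monoˡ-≤ (suc A) 2ᵃ<nᵇ ⟩
    (n ℕ.^ b) ℕ.^ suc A         ≡⟨ ℕ.^-*-assoc n b (suc A) ⟩
    n ℕ.^ (b ℕ.* suc A)         ∎
    where
    open ℕ.≤-Reasoning
    A = 2 ℕ.^ a

  n<2^n : ∀ m → m ℕ.< 2 ℕ.^ m
  n<2^n zero    = ℕ.s≤s ℕ.z≤n
  n<2^n (suc m) = ℕ.+-mono-≤ (ℕ.m^n>0 2 m) (ℕ.≤-trans (n<2^n m) (ℕ.≤-reflexive (sym (ℕ.+-identityʳ _))))

  cross : ∀ {p q} → 0ℚ ≤ p → p < q → ℤ.∣ ↥ p ∣ ℕ.* ↧ₙ q ℕ.≤ ℤ.∣ ↥ q ∣ ℕ.* ↧ₙ p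
  cross {mkℚ (ℤ.+ a) d _} {mkℚ (ℤ.+ c) e _} _ (*<* lt)
    rewrite sym (ℤ.pos-* a (suc e)) | sym (ℤ.pos-* c (suc d)) = ℕ.<⇒≤ (ℤ.drop‿+<+ lt)
  cross {mkℚ (ℤ.+ a) d _} {mkℚ -[1+ c ] e _} _ (*<* lt)
    rewrite sym (ℤ.pos-* a (suc e)) = contradiction lt λ ()
  cross {mkℚ -[1+ a ] d _} (*≤* ())

-- For q = a/b ≥ 0, q < log₂ n means 2ᵃ < nᵇ.
log₂ : ℕ → ℝ≥0
log₂ n = record
  { Below    = B
  ; negative = inj₁
  ; bounded  = mkℚ (ℤ.+ n) 0 (coprime-sym (1-coprimeTo n)) , bnd
  ; lower    = low
  ; open′    = opn
  ; located  = loc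
  }
  where
  open LogLemmas n

  B : ℚ → Set
  B q = q < 0ℚ ⊎ 2 ℕ.^ ℤ.∣ ↥ q ∣ ℕ.< n ℕ.^ ↧ₙ q

  bnd : ¬ B (mkℚ (ℤ.+ n) 0 (coprime-sym (1-coprimeTo n)))
  bnd (inj₁ (*<* lt)) rewrite ℤ.*-identityʳ (ℤ.+ n) = contradiction lt λ { (ℤ.+<+ ()) }
  bnd (inj₂ lt) = ℕ.<-asym (n<2^n n) (subst (2 ℕ.^ n ℕ.<_) (ℕ.*-identityʳ n) lt)

  low : ∀ {p q} → p < q → B q → B p
  low p<q (inj₁ q<0) = inj₁ (ℚ.<-trans p<q q<0)
  low {p@record{}} {q} p<q (inj₂ lt) with 0∨pos p
  ... | inj₁ p<0 = inj₁ p<0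
  ... | inj₂ 0≤p = inj₂ (scale ℤ.∣ ↥ q ∣ (↧ₙ q) ℤ.∣ ↥ p ∣ (↧ₙ p) lt (cross 0≤p p<q))

  loc : ∀ {p q} → p < q → B p ⊎ ¬ B q
  loc {p} p<q with p ℚ.<? 0ℚ | 2 ℕ.^ ℤ.∣ ↥ p ∣ ℕ.<? n ℕ.^ ↧ₙ p
  ... | yes p<0 | _      = inj₁ (inj₁ p<0)
  ... | no  _   | yes lt = inj₁ (inj₂ lt)
  ... | no  p≮0 | no ≮   = inj₂ λ bq → [ p≮0 , ≮ ]′ (low p<q bq)

  opn : ∀ {q} → B q → ∃[ r ] q < r × B r
  opn (inj₁ q<0) = let (r , q<r , r<0) = ℚ.<-dense q<0 in r , q<r , inj₁ r<0
  opn {mkℚ -[1+ a ] d _} (inj₂ _) = let (r , q<r , r<0) = ℚ.<-dense (*<* ℤ.-<+) in r , q<r , inj₁ r<0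
  opn {q@(mkℚ (ℤ.+ a) d _)} (inj₂ lt) = r , q<r , inj₂ (r<log r r≃)
    where
    m = 2 ℕ.^ a
    a′ = suc (a ℕ.* suc m)
    d′ = m ℕ.+ d ℕ.* suc m
    r = ℚ.fromℚᵘ (ℚᵘ.mkℚᵘ (ℤ.+ a′) d′)
    r≃ : ℚ.toℚᵘ r ℚᵘ.≃ ℚᵘ.mkℚᵘ (ℤ.+ a′) d′
    r≃ = ℚ.toℚᵘ-fromℚᵘ (ℚᵘ.mkℚᵘ (ℤ.+ a′) d′)
    q<r′ : ℚ.toℚᵘ q ℚᵘ.< ℚᵘ.mkℚᵘ (ℤ.+ a′) d′
    q<r′ = ℚᵘ.*<* (subst₂ ℤ._<_ (ℤ.pos-* a (suc d′)) (ℤ.pos-* a′ (suc d)) (ℤ.+<+ (begin-strict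
      a ℕ.* (suc d ℕ.* suc m)            ≡⟨ N.solve 3 (λ a d m → a N.:* (d N.:* m) N.:= a N.:* m N.:* d) refl a (suc d) (suc m) ⟩
      a ℕ.* suc m ℕ.* suc d              <⟨ ℕ.*-monoˡ-< (suc d) (ℕ.n<1+n (a ℕ.* suc m)) ⟩
      a′ ℕ.* suc d                       ∎)))
      where
      open ℕ.≤-Reasoning
      module N = ℕ-Solver
    q<r : q < r
    q<r = ℚ.toℚᵘ-cancel-< (ℚᵘ.<-respʳ-≃ (ℚᵘ.≃-sym r≃) q<r′)
    r<log : ∀ r → ℚ.toℚᵘ r ℚᵘ.≃ ℚᵘ.mkℚᵘ (ℤ.+ a′) d′ → 2 ℕ.^ ℤ.∣ ↥ r ∣ ℕ.< n ℕ.^ ↧ₙ r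
    r<log (mkℚ s e _) (ℚᵘ.*≡* eq) = scale a′ (suc d′) ℤ.∣ s ∣ (suc e) (improve a (suc d) lt)
      (ℕ.≤-reflexive (trans (sym (ℤ.abs-* s (ℤ.+ suc d′))) (trans (cong ℤ.∣_∣ eq) (ℤ.abs-* (ℤ.+ a′) (ℤ.+ suc e)))))

instance
  fromℕ-positive : ∀ {m} {{_ : ℕ.NonZero m}} → Positive (fromℕ m)
  fromℕ-positive {suc m} = positive (subst (0ℚ <_) (sym (ι-suc m)) (subst (_< 1ℚ + ι m) (ℚ.+-identityʳ 0ℚ) (ℚ.+-mono-<-≤ 0<1 (0≤ι m))))

  *-positive : ∀ {x y} {{_ : Positive x}} {{_ : Positive y}} → Positive (x *ᴿ y)
  *-positive {x} {y} {{positive 0<x}} {{positive 0<y}} =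
    let (a , 0<a , a<x) = ℝ≥0.open′ x 0<x
        (b , 0<b , b<y) = ℝ≥0.open′ y 0<y
    in positive (inj₂ (a , b , ℚ.<⇒≤ 0<a , ℚ.<⇒≤ 0<b , a<x , b<y , 0<-* 0<a 0<b))

  log₂-positive : ∀ {n} → Positive (log₂ (suc (suc n)))
  log₂-positive = positive (inj₂ (ℕ.s≤s (ℕ.s≤s ℕ.z≤n)))

-- x divided by log₂ n.  Since log₂ 1 = 0, the value for n ≤ 1 is a
-- placeholder; it is harmless below because being an expander is a
-- vacuous condition on graphs with at most one vertex.
infixl 7 _/log₂_

_/log₂_ : ℝ≥0 → ℕ → ℝ≥0
x /log₂ 0               = fromℕ 0
x /log₂ 1               = fromℕ 0
x /log₂ n@(suc (suc _)) = x /ᴿ log₂ n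

record Graph (n : ℕ) : Set₁ where
  field
    Adj         : Rel (Fin n) 0ℓ
    adj?        : Decidable Adj
    symmetric   : Symmetric Adj
    irreflexive : Irreflexive _≡_ Adj

open Graph using (Adj; adj?)

module _ {n : ℕ} where

  -- Each edge is listed once, as the pair of its ends in increasing order.
  edges : Graph n → List (Fin n × Fin n)
  edges G = filter (λ (u , v) → (u Fin.<? v) ×-dec adj? G u v)
                   (cartesianProduct (allFin n) (allFin n))

  ∣E_∣ : Graph n → ℕ
  ∣E G ∣ = length (edges G)

  -- A set of edges is represented by the spanning graph having exactly
  -- these edges, so that F ⊆ᴱ G says F ⊆ E(G).
  infix 4 _⊆ᴱ_

  _⊆ᴱ_ : Graph n → Graph n → Set
  F ⊆ᴱ G = ∀ u v → Adj F u v → Adj G u v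

  infixl 6 _∖_

  _∖_ : Graph n → Graph n → Graph n
  G ∖ F = record
    { Adj         = λ u v → Adj G u v × ¬ Adj F u v
    ; adj?        = λ u v → adj? G u v ×-dec ¬? (adj? F u v)
    ; symmetric   = λ (g , ¬f) → Graph.symmetric G g , ¬f ∘ Graph.symmetric F
    ; irreflexive = λ u≡v (g , _) → Graph.irreflexive G u≡v g
    }

  N : Graph n → Subset n → Subset n
  N G U = tabulate λ v → does (¬? (v ∈? U) ×-dec Fin.any? λ u → (u ∈? U) ×-dec adj? G u v)

  EdgeDisjoint : ∀ {k} → (Fin k → Graph n) → Set
  EdgeDisjoint H = ∀ i j → i ≢ j → ∀ u v → ¬ (Adj (H i) u v × Adj (H j) u v)

  IsEdgeUnion : ∀ {k} → Graph n → (Fin k → Graph n) → Set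
  IsEdgeUnion G H = ∀ u v → Adj G u v ⇔ (∃[ i ] Adj (H i) u v)

  IsExpander : ℝ≥0 → ℝ≥0 → Graph n → Set₁
  IsExpander ε s G =
    ∀ (U : Subset n) (F : Graph n) → F ⊆ᴱ G →
    1 ℕ.≤ ∣ U ∣ → 3 ℕ.* ∣ U ∣ ℕ.≤ 2 ℕ.* n →
    fromℕ ∣E F ∣ ≤ᴿ s *ᴿ fromℕ ∣ U ∣ →
    ε *ᴿ fromℕ ∣ U ∣ /log₂ n /log₂ n ≤ᴿ fromℕ ∣ N (G ∖ F) U ∣

{-# OPTIONS --safe #-}
module Submission where

open import Defs
open import Data.Nat using (ℕ; NonZero; _*_; _^_)
open import Data.Fin using (Fin)
open import Data.Product using (Σ-syntax; _×_)
open import Data.Nat using (zero; suc; pred; _+_; _∸_; _/_; _%_; _≤_; _<_; _≤?_; _<?_; z≤n; s≤s; s≤s⁻¹; >-nonZero; >-nonZero⁻¹)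
import Data.Nat.Properties as ℕ
import Data.Nat.DivMod as ℕ
open import Data.Nat.ListAction using (sum; product)
open import Data.Nat.ListAction.Properties using (sum-++)
open import Data.Nat.Solver using (module +-*-Solver)
open import Data.Integer as ℤ using ()
open import Data.Rational as ℚ using (ℚ; 0ℚ; 1ℚ; ½; *<*)
import Data.Rational.Properties as ℚ
import Data.Rational.Solver as ℚ
open import Data.Bool using (true; false; if_then_else_)
import Data.Fin as Fin
import Data.Fin.Properties as Fin
open import Data.Fin.Subset using (Subset; ∣_∣; ∁; inside; outside) renaming (_∈_ to _∈ˢ_; _∉_ to _∉ˢ_; _⊆_ to _⊆ˢ_)
import Data.Fin.Subset.Properties as Subset
open import Data.List using (List; []; _∷_; _++_; map; length; filter; allFin; cartesianProduct)
import Data.List.Properties as List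
open import Data.List.Membership.Propositional using (_∈_)
import Data.List.Membership.Propositional.Properties as ∈
open import Data.List.Relation.Binary.Sublist.Propositional using (⊆-refl)
import Data.List.Relation.Binary.Sublist.Propositional.Properties as Sublist
open import Data.List.Relation.Unary.All as All using (All)
open import Data.List.Relation.Unary.AllPairs using ([]; _∷_)
open import Data.List.Relation.Unary.Any using (here; there)
open import Data.List.Relation.Unary.Unique.Propositional using (Unique)
import Data.List.Relation.Unary.Unique.Propositional.Properties as Unique
open import Data.Vec using ([]; _∷_)
open import Data.Vec.Properties using (lookup∘tabulate; []=⇒lookup; lookup⇒[]=)
open import Data.Product using (∃-syntax; _,_; proj₁; proj₂)
import Data.Product.Properties as Product
open import Data.Sum using (_⊎_; inj₁; inj₂; swap)
open import Data.Empty using (⊥-elim)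
open import Function using (_∘_; id; mk⇔)
open import Level using (0ℓ)
open import Relation.Binary using (DecidableEquality; tri<; tri≈; tri>)
open import Relation.Binary.PropositionalEquality hiding (J)
open import Relation.Nullary using (¬_; Dec; yes; no; does; ¬?; _×-dec_; _⊎-dec_)
open import Relation.Nullary.Decidable using (decidable-stable; dec-true; toWitness)
open import Relation.Unary using (Pred)
import Relation.Unary as U
open RationalLemmas
open ℝ≥0 using (Below)
open Graph using (Adj; adj?)

-- An (ε, s)-expander is a graph in which more than s|U| edges leave U ∪ S from U, for every
-- nonempty U with |U| ≤ 2n/3 and every S disjoint from U with |S| < ε|U|/log² n: otherwise these
-- edges could be deleted, leaving N(U) ⊆ S.  Colour the edges of G uniformly at random with k
-- colours.  For fixed U and S with |S| ≤ |U|, the number e of these edges having a fixed colour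
-- satisfies E[2^(−e)] ≤ (1 − 1/(2k))^(s|U|) ≤ 2^(−s|U|/(2k)), so that e ≤ s|U|/(8k) has probability
-- at most 2^(−3s|U|/(8k)).  This beats the number of choices of U, S and the colour because
-- s/k is much larger than k + log n, and the colour classes are then even
-- (ε, s/(8k))-expanders, where √(sε)/(8k log n) ≤ s/(8k).

-- Finite sums and products over lists.

module _ {A : Set} where

  ∑ : List A → (A → ℕ) → ℕ
  ∑ xs f = sum (map f xs)

  ∏ : List A → (A → ℕ) → ℕ
  ∏ xs f = product (map f xs)

  ∑-cong : ∀ {f g : A → ℕ} xs → (∀ x → f x ≡ g x) → ∑ xs f ≡ ∑ xs g
  ∑-cong xs f≡g = cong sum (List.map-cong f≡g xs)

  ∑-mono : ∀ {f g : A → ℕ} xs → (∀ x → f x ≤ g x) → ∑ xs f ≤ ∑ xs g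
  ∑-mono []       f≤g = z≤n
  ∑-mono (x ∷ xs) f≤g = ℕ.+-mono-≤ (f≤g x) (∑-mono xs f≤g)

  ∑-zero : ∀ (xs : List A) → ∑ xs (λ _ → 0) ≡ 0
  ∑-zero []       = refl
  ∑-zero (x ∷ xs) = ∑-zero xs

  ∑-const : ∀ (xs : List A) c → ∑ xs (λ _ → c) ≡ length xs * c
  ∑-const []       c = refl
  ∑-const (x ∷ xs) c = cong (c +_) (∑-const xs c)

  ∑-+ : ∀ (f g : A → ℕ) xs → ∑ xs (λ x → f x + g x) ≡ ∑ xs f + ∑ xs g
  ∑-+ f g []       = refl
  ∑-+ f g (x ∷ xs) = trans (cong (f x + g x +_) (∑-+ f g xs))
    (solve 4 (λ a b c d → a :+ b :+ (c :+ d) := a :+ c :+ (b :+ d)) refl (f x) (g x) (∑ xs f) (∑ xs g))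
    where open +-*-Solver

  ∑-*ˡ : ∀ c (f : A → ℕ) xs → ∑ xs (λ x → c * f x) ≡ c * ∑ xs f
  ∑-*ˡ c f []       = sym (ℕ.*-zeroʳ c)
  ∑-*ˡ c f (x ∷ xs) = trans (cong (c * f x +_) (∑-*ˡ c f xs)) (sym (ℕ.*-distribˡ-+ c (f x) (∑ xs f)))

  ∑-*ʳ : ∀ c (f : A → ℕ) xs → ∑ xs (λ x → f x * c) ≡ ∑ xs f * c
  ∑-*ʳ c f xs = trans (∑-cong xs (λ x → ℕ.*-comm (f x) c)) (trans (∑-*ˡ c f xs) (ℕ.*-comm c (∑ xs f)))

  ∑-++ : ∀ (f : A → ℕ) xs ys → ∑ (xs ++ ys) f ≡ ∑ xs f + ∑ ys f
  ∑-++ f xs ys = trans (cong sum (List.map-++ f xs ys)) (sum-++ (map f xs) (map f ys))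

  term≤∑ : ∀ (f : A → ℕ) {x xs} → x ∈ xs → f x ≤ ∑ xs f
  term≤∑ f {xs = x ∷ xs} (here refl)  = ℕ.m≤m+n (f x) (∑ xs f)
  term≤∑ f {xs = y ∷ xs} (there x∈xs) = ℕ.≤-trans (term≤∑ f x∈xs) (ℕ.m≤n+m (∑ xs f) (f y))

  below-average : ∀ (f : A → ℕ) xs {T} → ∑ xs f < length xs * T → ∃[ x ] f x < T
  below-average f (x ∷ xs) {T} lt with f x <? T
  ... | yes fx<T = x , fx<T
  ... | no  fx≮T = below-average f xs (ℕ.+-cancelˡ-< T (∑ xs f) _
                     (ℕ.≤-<-trans (ℕ.+-monoˡ-≤ (∑ xs f) (ℕ.≮⇒≥ fx≮T)) lt))

  ∏-cong : ∀ {f g : A → ℕ} xs → (∀ x → f x ≡ g x) → ∏ xs f ≡ ∏ xs g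
  ∏-cong xs f≡g = cong product (List.map-cong f≡g xs)

  ∏-cong-local : ∀ {f g : A → ℕ} {xs} → All (λ x → f x ≡ g x) xs → ∏ xs f ≡ ∏ xs g
  ∏-cong-local eqs = cong product (List.map-cong-local eqs)

  -- With f entries satisfying `P` the product is a^f b^(m - f); the extra factor b^f on the left
  -- avoids the subtraction.
  ∏-if : ∀ {P : Pred A 0ℓ} (P? : U.Decidable P) a b xs →
         ∏ xs (λ x → if does (P? x) then a else b) * b ^ length (filter P? xs) ≡
         a ^ length (filter P? xs) * b ^ length xs
  ∏-if P? a b []       = refl
  ∏-if P? a b (x ∷ xs) with does (P? x)
  ... | true  = trans
    (solve 4 (λ a b p f → a :* p :* (b :* f) := a :* b :* (p :* f)) refl a b _ _)
    (trans (cong (a * b *_) (∏-if P? a b xs))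
    (solve 4 (λ a b f l → a :* b :* (f :* l) := a :* f :* (b :* l)) refl a b (a ^ length (filter P? xs)) (b ^ length xs)))
    where open +-*-Solver
  ... | false = trans (ℕ.*-assoc b _ _) (trans (cong (b *_) (∏-if P? a b xs))
    (solve 3 (λ b f l → b :* (f :* l) := f :* (b :* l)) refl b (a ^ length (filter P? xs)) (b ^ length xs)))
    where open +-*-Solver

∑-map : ∀ {A B : Set} (g : A → B) (f : B → ℕ) xs → ∑ (map g xs) f ≡ ∑ xs (f ∘ g)
∑-map g f xs = cong sum (sym (List.map-∘ xs))

∑-swap : ∀ {A B : Set} (f : A → B → ℕ) xs ys → ∑ xs (λ x → ∑ ys (f x)) ≡ ∑ ys (λ y → ∑ xs (λ x → f x y))
∑-swap f []       ys = sym (∑-zero ys)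
∑-swap f (x ∷ xs) ys = trans (cong (∑ ys (f x) +_) (∑-swap f xs ys)) (sym (∑-+ (f x) _ ys))

∑-cartesianProduct : ∀ {A B : Set} (f : A × B → ℕ) xs ys →
                     ∑ (cartesianProduct xs ys) f ≡ ∑ xs (λ x → ∑ ys (λ y → f (x , y)))
∑-cartesianProduct f []       ys = refl
∑-cartesianProduct f (x ∷ xs) ys = trans (∑-++ f (map (x ,_) ys) (cartesianProduct xs ys))
  (cong₂ _+_ (∑-map (x ,_) f ys) (∑-cartesianProduct f xs ys))

∑-allFin-suc : ∀ k (f : Fin (suc k) → ℕ) → ∑ (allFin (suc k)) f ≡ f Fin.zero + ∑ (allFin k) (f ∘ Fin.suc)
∑-allFin-suc k f = cong ((f Fin.zero +_) ∘ sum)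
  (trans (List.map-tabulate Fin.suc f) (sym (List.map-tabulate id (f ∘ Fin.suc))))

-- One colour contributes 1 and the other k - 1 contribute 2 each, so the sum is 2k - 1.
∑-allFin-≟ : ∀ {k} (i : Fin k) → suc (∑ (allFin k) (λ c → if does (i Fin.≟ c) then 1 else 2)) ≡ 2 * k
∑-allFin-≟ {suc k} i = trans (cong suc (∑-allFin-suc k _)) (step i)
  where
  twos : ∑ (allFin k) (λ _ → 2) ≡ k * 2
  twos = trans (∑-const (allFin k) 2) (cong (_* 2) (List.length-tabulate {n = k} id))
  step : ∀ i → suc ((if does (i Fin.≟ Fin.zero) then 1 else 2) +
                    ∑ (allFin k) (λ c → if does (i Fin.≟ Fin.suc c) then 1 else 2)) ≡ 2 * suc k
  step Fin.zero    = trans (cong (2 +_) (trans twos (ℕ.*-comm k 2))) (sym (ℕ.*-suc 2 k))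
  step (Fin.suc i) = trans (cong (2 +_) (∑-allFin-≟ i)) (sym (ℕ.*-suc 2 k))

-- Derandomisation.

-- The method of conditional expectations: w j x c is the factor that the event j picks up
-- when x is given the colour c.
module _ {A J C : Set} (_≟_ : DecidableEquality A) (c₀ : C) (cs : List C)
         (js : List J) (w : J → A → C → ℕ) where

  -- The weights `a` absorb the factors of the elements already coloured. Exchanging the two sums
  -- turns the hypothesis into an average over the colour of `x`, so some colour keeps the remaining
  -- total below its share. Uniqueness ensures that recolouring `x` leaves the later factors alone.
  derandomise : ∀ xs → Unique xs → (a : J → ℕ) {T : ℕ} →
                ∑ js (λ j → a j * ∏ xs (λ x → ∑ cs (w j x))) < length cs ^ length xs * T →
                Σ[ c ∈ (A → C) ] ∑ js (λ j → a j * ∏ xs (λ x → w j x (c x))) < T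
  -- `c₀` is only the default colour of elements outside the list.
  derandomise []       _            a {T} lt = (λ _ → c₀) , subst (∑ js (λ j → a j * 1) <_) (ℕ.*-identityˡ T) lt
  derandomise (x ∷ xs) (x∉ ∷ uniq) a {T} lt =
    choose (below-average _ cs (subst₂ _<_ expand (ℕ.*-assoc (length cs) (length cs ^ length xs) T) lt))
    where
    R : J → ℕ
    R j = ∏ xs (λ y → ∑ cs (w j y))

    expand : ∑ js (λ j → a j * (∑ cs (w j x) * R j)) ≡ ∑ cs (λ c → ∑ js (λ j → a j * w j x c * R j))
    expand = trans (∑-cong js (λ j → trans (sym (ℕ.*-assoc (a j) _ (R j)))
        (trans (cong (_* R j) (sym (∑-*ˡ (a j) (w j x) cs))) (sym (∑-*ʳ (R j) _ cs)))))
      (∑-swap _ js cs)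

    update : C → (A → C) → A → C
    update c* c y = if does (x ≟ y) then c* else c y

    update-here : ∀ c* c → update c* c x ≡ c*
    update-here c* c with x ≟ x
    ... | yes _   = refl
    ... | no  x≢x = ⊥-elim (x≢x refl)

    update-there : ∀ c* c {y} → x ≢ y → c y ≡ update c* c y
    update-there c* c {y} x≢y with x ≟ y
    ... | yes x≡y = ⊥-elim (x≢y x≡y)
    ... | no  _   = refl

    retract : ∀ c* c j → a j * w j x c* * ∏ xs (λ y → w j y (c y)) ≡
                         a j * ∏ (x ∷ xs) (λ y → w j y (update c* c y))
    retract c* c j = trans (ℕ.*-assoc (a j) (w j x c*) _) (cong (a j *_)
      (cong₂ _*_ (cong (w j x) (sym (update-here c* c)))
                 (∏-cong-local (All.map (λ {y} x≢y → cong (w j y) (update-there c* c x≢y)) x∉))))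

    finish : ∀ c* → Σ[ c ∈ (A → C) ] ∑ js (λ j → a j * w j x c* * ∏ xs (λ y → w j y (c y))) < T →
             Σ[ c ∈ (A → C) ] ∑ js (λ j → a j * ∏ (x ∷ xs) (λ y → w j y (c y))) < T
    finish c* (c , below) = update c* c , subst (_< T) (∑-cong js (retract c* c)) below

    choose : ∃[ c ] ∑ js (λ j → a j * w j x c * R j) < length cs ^ length xs * T →
             Σ[ c ∈ (A → C) ] ∑ js (λ j → a j * ∏ (x ∷ xs) (λ y → w j y (c y))) < T
    choose (c* , below) = finish c* (derandomise xs uniq (λ j → a j * w j x c*) below)

-- Sums over all subsets and exponential inequalities.

subsets : ∀ n → List (Subset n)
subsets zero    = [] ∷ []
subsets (suc n) = map (outside ∷_) (subsets n) ++ map (inside ∷_) (subsets n)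

∈-subsets : ∀ {n} (p : Subset n) → p ∈ subsets n
∈-subsets []            = here refl
∈-subsets (outside ∷ p) = ∈.∈-++⁺ˡ (∈.∈-map⁺ (outside ∷_) (∈-subsets p))
∈-subsets (inside ∷ p)  = ∈.∈-++⁺ʳ (map (outside ∷_) (subsets _)) (∈.∈-map⁺ (inside ∷_) (∈-subsets p))

-- The binomial theorem: each element contributes a factor 1 if inside and `y` if outside.
∑-subsets : ∀ n y → ∑ (subsets n) (λ p → y ^ ∣ ∁ p ∣) ≡ suc y ^ n
∑-subsets zero    y = refl
∑-subsets (suc n) y = begin
  ∑ (map (outside ∷_) (subsets n) ++ map (inside ∷_) (subsets n)) (λ p → y ^ ∣ ∁ p ∣)
    ≡⟨ ∑-++ _ (map (outside ∷_) (subsets n)) _ ⟩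
  ∑ (map (outside ∷_) (subsets n)) (λ p → y ^ ∣ ∁ p ∣) + ∑ (map (inside ∷_) (subsets n)) (λ p → y ^ ∣ ∁ p ∣)
    ≡⟨ cong₂ _+_ (trans (∑-map _ _ (subsets n)) (∑-*ˡ y _ (subsets n))) (∑-map _ _ (subsets n)) ⟩
  y * S + S
    ≡⟨ ℕ.+-comm (y * S) S ⟩
  suc y * S
    ≡⟨ cong (suc y *_) (∑-subsets n y) ⟩
  suc y * suc y ^ n ∎
  where
  open ≡-Reasoning
  S = ∑ (subsets n) (λ p → y ^ ∣ ∁ p ∣)

^-∣∁∣ : ∀ {n} (p : Subset n) y → y ^ ∣ p ∣ * y ^ ∣ ∁ p ∣ ≡ y ^ n
^-∣∁∣ []            y = refl
^-∣∁∣ (inside ∷ p)  y = trans (ℕ.*-assoc y _ _) (cong (y *_) (^-∣∁∣ p y))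
^-∣∁∣ (outside ∷ p) y = trans
  (solve 3 (λ y a b → a :* (y :* b) := y :* (a :* b)) refl y (y ^ ∣ p ∣) (y ^ ∣ ∁ p ∣)) (cong (y *_) (^-∣∁∣ p y))
  where open +-*-Solver

-- Each of the n + 1 terms of the binomial expansion is at most y^n when n ≤ y. The induction needs
-- only (1 + y)(1 + n) ≤ y(2 + n), which is n + 1 ≤ y.
[1+y]^n≤[1+n]y^n : ∀ {y} n → n ≤ y → suc y ^ n ≤ suc n * y ^ n
[1+y]^n≤[1+n]y^n         zero    _   = ℕ.≤-refl
[1+y]^n≤[1+n]y^n {y} (suc n) n<y = begin
  suc y * suc y ^ n         ≤⟨ ℕ.*-monoʳ-≤ (suc y) ([1+y]^n≤[1+n]y^n n (ℕ.<⇒≤ n<y)) ⟩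
  suc y * (suc n * y ^ n)   ≡⟨ solve 3 (λ y n p → (con 1 :+ y) :* ((con 1 :+ n) :* p) :=
                                 (con 1 :+ n) :* p :+ (y :* ((con 1 :+ n) :* p))) refl y n (y ^ n) ⟩
  suc n * y ^ n + y * (suc n * y ^ n)
                            ≤⟨ ℕ.+-monoˡ-≤ _ (ℕ.*-monoˡ-≤ (y ^ n) n<y) ⟩
  y * y ^ n + y * (suc n * y ^ n)
                            ≡⟨ solve 3 (λ y n p → y :* p :+ y :* ((con 1 :+ n) :* p) :=
                                 (con 2 :+ n) :* (y :* p)) refl y n (y ^ n) ⟩
  suc (suc n) * (y * y ^ n) ∎
  where
  open ℕ.≤-Reasoning
  open +-*-Solver

^-distribʳ-* : ∀ r a b → (a * b) ^ r ≡ a ^ r * b ^ r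
^-distribʳ-* zero    a b = refl
^-distribʳ-* (suc r) a b = trans (cong (a * b *_) (^-distribʳ-* r a b))
  (solve 4 (λ a b x y → a :* b :* (x :* y) := a :* x :* (b :* y)) refl a b (a ^ r) (b ^ r))
  where open +-*-Solver

-- This is (1 − 1/(q + 1))^(q + 1) ≤ 1/2, applied r times.
2^r*q^f≤[1+q]^f : ∀ {q} r f → 0 < q → suc q * r ≤ f → 2 ^ r * q ^ f ≤ suc q ^ f
2^r*q^f≤[1+q]^f {q} r f 0<q qr≤f = begin
  2 ^ r * q ^ f                               ≡⟨ cong (λ f → 2 ^ r * q ^ f) (ℕ.m+[n∸m]≡n qr≤f) ⟨
  2 ^ r * q ^ (suc q * r + g)                 ≡⟨ cong (2 ^ r *_) (ℕ.^-distribˡ-+-* q (suc q * r) g) ⟩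
  2 ^ r * (q ^ (suc q * r) * q ^ g)           ≡⟨ ℕ.*-assoc (2 ^ r) _ _ ⟨
  2 ^ r * q ^ (suc q * r) * q ^ g             ≡⟨ cong (λ z → 2 ^ r * z * q ^ g) (ℕ.^-*-assoc q (suc q) r) ⟨
  2 ^ r * (q ^ suc q) ^ r * q ^ g             ≡⟨ cong (_* q ^ g) (^-distribʳ-* r 2 (q ^ suc q)) ⟨
  (2 * q ^ suc q) ^ r * q ^ g                 ≤⟨ ℕ.*-mono-≤ (ℕ.^-monoˡ-≤ r (ℕ.<⇒≤ (LogLemmas.double< 0 q 0<q)))
                                                            (ℕ.^-monoˡ-≤ g (ℕ.n≤1+n q)) ⟩
  (suc q ^ suc q) ^ r * suc q ^ g             ≡⟨ cong (_* suc q ^ g) (ℕ.^-*-assoc (suc q) (suc q) r) ⟩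
  suc q ^ (suc q * r) * suc q ^ g             ≡⟨ ℕ.^-distribˡ-+-* (suc q) (suc q * r) g ⟨
  suc q ^ (suc q * r + g)                     ≡⟨ cong (suc q ^_) (ℕ.m+[n∸m]≡n qr≤f) ⟩
  suc q ^ f                                   ∎
  where
  open ℕ.≤-Reasoning
  g = f ∸ suc q * r

-- Relative to all factors being `suc q`, every `suc q` occurrences of the factor `q` at least halve
-- the product.
∏-if-≤ : ∀ {A : Set} {P : Pred A 0ℓ} (P? : U.Decidable P) xs {q} r → 0 < q → suc q * r ≤ length (filter P? xs) →
         2 ^ r * ∏ xs (λ x → if does (P? x) then q else suc q) ≤ suc q ^ length xs
∏-if-≤ P? xs {q} r 0<q r≤ = ℕ.*-cancelʳ-≤ _ _ (suc q ^ f) {{ℕ.m^n≢0 (suc q) f}} (begin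
  2 ^ r * Π * suc q ^ f            ≡⟨ ℕ.*-assoc (2 ^ r) Π _ ⟩
  2 ^ r * (Π * suc q ^ f)          ≡⟨ cong (2 ^ r *_) (∏-if P? q (suc q) xs) ⟩
  2 ^ r * (q ^ f * suc q ^ m)      ≡⟨ ℕ.*-assoc (2 ^ r) _ _ ⟨
  2 ^ r * q ^ f * suc q ^ m        ≤⟨ ℕ.*-monoˡ-≤ _ (2^r*q^f≤[1+q]^f r f 0<q r≤) ⟩
  suc q ^ f * suc q ^ m            ≡⟨ ℕ.*-comm (suc q ^ f) _ ⟩
  suc q ^ m * suc q ^ f            ∎)
  where
  open ℕ.≤-Reasoning
  f = length (filter P? xs)
  m = length xs
  Π = ∏ xs (λ x → if does (P? x) then q else suc q)

-- Random colourings with many hits for every event.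

module _ {A J : Set} {P : J → Pred A 0ℓ} (P? : ∀ j → U.Decidable (P j)) {k} (colour : J → Fin k) where

  hit? : ∀ (c : A → Fin k) j → U.Decidable (λ x → P j x × colour j ≡ c x)
  hit? c j x = P? j x ×-dec (colour j Fin.≟ c x)

  module _ (_≟_ : DecidableEquality A) {xs : List A} (xs! : Unique xs) {q} {{_ : NonZero k}}
           (1+q≡2k : suc q ≡ 2 * k) (js : List J) (a : J → ℕ) where

    -- Under a uniformly random colouring c, the expectation of 2^{-h} for the number h of
    -- hits of the event j is the product of a factor 1 − 1/(2k) for each element of P j.
    colouring-exists :
      ∑ js (λ j → a j * ∏ xs (λ x → if does (P? j x) then q else suc q)) < suc q ^ length xs →
      Σ[ c ∈ (A → Fin k) ] ∀ {j} → j ∈ js → a j < 2 ^ length (filter (hit? c j) xs)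
    colouring-exists lt = c , λ {j} j∈js →
      ℕ.*-cancelʳ-< (2 ^ m) _ _ (subst₂ _<_ (regroup j) (ℕ.*-comm (2 ^ m) _)
        (ℕ.*-monoˡ-< (2 ^ length (filter (hit? c j) xs)) {{ℕ.m^n≢0 2 (length (filter (hit? c j) xs))}}
          (ℕ.≤-<-trans (term≤∑ _ j∈js) (proj₂ found))))
      where
      m = length xs

      -- The factors ½ for a hit and 1 otherwise, doubled to stay in the naturals; the doubling is
      -- repaid by `2 ^ m` in `average` and `regroup`.
      w : J → A → Fin k → ℕ
      w j x c = if does (P? j x ×-dec (colour j Fin.≟ c)) then 1 else 2

      ∑-w : ∀ j x → ∑ (allFin k) (w j x) ≡ (if does (P? j x) then q else suc q)
      ∑-w j x with does (P? j x)
      ... | true  = ℕ.suc-injective (trans (∑-allFin-≟ (colour j)) (sym 1+q≡2k))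
      ... | false = trans (∑-const (allFin k) 2)
        (trans (cong (_* 2) (List.length-tabulate {n = k} id)) (trans (ℕ.*-comm k 2) (sym 1+q≡2k)))

      average : suc q ^ m ≡ length (allFin k) ^ m * 2 ^ m
      average = trans (cong (_^ m) (trans 1+q≡2k (trans (ℕ.*-comm 2 k) (cong (_* 2) (sym (List.length-tabulate {n = k} id))))))
        (^-distribʳ-* m (length (allFin k)) 2)

      found : Σ[ c ∈ (A → Fin k) ] ∑ js (λ j → a j * ∏ xs (λ x → w j x (c x))) < 2 ^ m
      found = derandomise _≟_ (Fin.fromℕ< (>-nonZero⁻¹ k)) (allFin k) js w xs xs! a
        (subst₂ _<_ (∑-cong js (λ j → cong (a j *_) (∏-cong xs (λ x → sym (∑-w j x))))) average lt)

      c = proj₁ found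

      regroup : ∀ j → a j * ∏ xs (λ x → w j x (c x)) * 2 ^ length (filter (hit? c j) xs) ≡ a j * 2 ^ m
      regroup j = trans (ℕ.*-assoc (a j) _ _) (cong (a j *_) (trans (∏-if (hit? c j) 1 2 xs)
        (trans (cong (_* 2 ^ m) (ℕ.^-zeroˡ (length (filter (hit? c j) xs)))) (ℕ.*-identityˡ _))))

-- Cuts and colour classes of a graph.

module _ {n : ℕ} where

  Sep : Subset n → Subset n → Fin n → Fin n → Set
  Sep U S u v = u ∈ˢ U × v ∉ˢ U × v ∉ˢ S

  sep? : ∀ U S u v → Dec (Sep U S u v)
  sep? U S u v = (u Subset.∈? U) ×-dec ¬? (v Subset.∈? U) ×-dec ¬? (v Subset.∈? S)

  -- The edges of `G` from U to the outside of U ∪ S, taken in both orientations to give a symmetric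
  -- relation.
  cut : Graph n → Subset n → Subset n → Graph n
  cut G U S = record
    { Adj         = λ u v → Adj G u v × (Sep U S u v ⊎ Sep U S v u)
    ; adj?        = λ u v → adj? G u v ×-dec (sep? U S u v ⊎-dec sep? U S v u)
    ; symmetric   = λ (g , sep) → Graph.symmetric G g , swap sep
    ; irreflexive = λ u≡v (g , _) → Graph.irreflexive G u≡v g
    }

  module _ {k : ℕ} (G : Graph n) (c : Fin n × Fin n → Fin k) where

    HasColour : Fin k → Fin n → Fin n → Set
    HasColour i u v = u Fin.< v × c (u , v) ≡ i

    -- The colour of an edge is read at its ends in increasing order, so `c` need not be symmetric.
    colourClass : Fin k → Graph n
    colourClass i = record
      { Adj         = λ u v → Adj G u v × (HasColour i u v ⊎ HasColour i v u)
      ; adj?        = λ u v → adj? G u v ×-dec (hasColour? u v ⊎-dec hasColour? v u)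
      ; symmetric   = λ (g , col) → Graph.symmetric G g , swap col
      ; irreflexive = λ u≡v (g , _) → Graph.irreflexive G u≡v g
      }
      where
      hasColour? : ∀ u v → Dec (HasColour i u v)
      hasColour? u v = (u Fin.<? v) ×-dec (c (u , v) Fin.≟ i)

    colourClass-disjoint : EdgeDisjoint colourClass
    colourClass-disjoint i j i≢j u v ((_ , inj₁ (_ , ci))   , (_ , inj₁ (_ , cj)))   = i≢j (trans (sym ci) cj)
    colourClass-disjoint i j i≢j u v ((_ , inj₁ (u<v , _)) , (_ , inj₂ (v<u , _))) = Fin.<-asym u<v v<u
    colourClass-disjoint i j i≢j u v ((_ , inj₂ (v<u , _)) , (_ , inj₁ (u<v , _))) = Fin.<-asym u<v v<u
    colourClass-disjoint i j i≢j u v ((_ , inj₂ (_ , ci))   , (_ , inj₂ (_ , cj)))   = i≢j (trans (sym ci) cj)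

    colourClass-union : IsEdgeUnion G colourClass
    colourClass-union u v = mk⇔ to (proj₁ ∘ proj₂)
      where
      to : Adj G u v → ∃[ i ] Adj (colourClass i) u v
      to g with Fin.<-cmp u v
      ... | tri< u<v _ _ = c (u , v) , g , inj₁ (u<v , refl)
      ... | tri≈ _ u≡v _ = ⊥-elim (Graph.irreflexive G u≡v g)
      ... | tri> _ _ v<u = c (v , u) , g , inj₂ (v<u , refl)

    -- Every large cut keeps more than a 1/(8k) part of s|U| in each colour. Strictness lets this
    -- contradict the bound on the number of deleted edges.
    Colourful : ℕ → Set
    Colourful s = ∀ U S i → 1 ≤ ∣ U ∣ → ∣ S ∣ ≤ ∣ U ∣ → s * ∣ U ∣ ≤ ∣E cut G U S ∣ →
                  s * ∣ U ∣ < 8 * k * ∣E cut (colourClass i) U S ∣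

  -- The predicate by which `edges` filters `pairs`, named so that edge counts are lengths of
  -- filtered lists by definition.
  IsEdge : Graph n → Pred (Fin n × Fin n) 0ℓ
  IsEdge F (u , v) = u Fin.< v × Adj F u v

  edge? : (F : Graph n) → U.Decidable (IsEdge F)
  edge? F (u , v) = (u Fin.<? v) ×-dec adj? F u v

  pairs : List (Fin n × Fin n)
  pairs = cartesianProduct (allFin n) (allFin n)

  pairs! : Unique pairs
  pairs! = Unique.cartesianProduct⁺ (Unique.allFin⁺ n) (Unique.allFin⁺ n)

  ∣E∣-mono : ∀ {F H : Graph n} → F ⊆ᴱ H → ∣E F ∣ ≤ ∣E H ∣
  ∣E∣-mono {F} {H} F⊆H = Sublist.length-mono-≤
    (Sublist.filter⁺ (edge? F) (edge? H) (λ { refl (u<v , f) → u<v , F⊆H _ _ f }) (⊆-refl {x = pairs}))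

  -- The union bound over U, S and the colour.

  module _ (k : ℕ) {{_ : NonZero k}} (s d : ℕ) (n<2ᵈ : n < 2 ^ d) (k<2ᵈ : k < 2 ^ d) (16kd≤s : 16 * k * d ≤ s)
           (G : Graph n) where

    private
      instance _ = ℕ.m*n≢0 8 k

      y q m : ℕ
      y = 2 ^ d
      -- With q = 2k - 1 the ratio q/(q + 1) is the expected factor 1 - 1/(2k) of a cut edge.
      q = pred (2 * k)
      m = length pairs

      1+q≡2k : suc q ≡ 2 * k
      1+q≡2k = ℕ.suc-pred (2 * k) {{ℕ.m*n≢0 2 k}}

      0<q : 0 < q
      0<q = s≤s⁻¹ (subst (2 ≤_) (sym 1+q≡2k) (ℕ.m≤m*n 2 k))

      Event : Set
      Event = (Subset n × Subset n) × Fin k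

      events : List Event
      events = cartesianProduct (cartesianProduct (subsets n) (subsets n)) (allFin k)

      InCut : Event → Pred (Fin n × Fin n) 0ℓ
      InCut ((U , S) , _) = IsEdge (cut G U S)

      inCut? : ∀ j → U.Decidable (InCut j)
      inCut? ((U , S) , _) = edge? (cut G U S)

      Relevant : Subset n → Subset n → Set
      Relevant U S = 1 ≤ ∣ U ∣ × ∣ S ∣ ≤ ∣ U ∣ × s * ∣ U ∣ ≤ ∣E cut G U S ∣

      relevant? : ∀ U S → Dec (Relevant U S)
      relevant? U S = (1 ≤? ∣ U ∣) ×-dec (∣ S ∣ ≤? ∣ U ∣) ×-dec (s * ∣ U ∣ ≤? ∣E cut G U S ∣)

      t : Subset n → ℕ
      t U = s * ∣ U ∣ / (8 * k)

      -- The weight in Markov's inequality: being below `2 ^ h`, for h hits, means t < h for a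
      -- relevant event and nothing for any other.
      a : Event → ℕ
      a ((U , S) , _) = if does (relevant? U S) then 2 ^ t U else 0

      Π : Event → ℕ
      Π j = ∏ pairs (λ x → if does (inCut? j x) then q else suc q)

      -- From 16kd ≤ s follows 2d|U| ≤ t, while 3 + |U| + |S| ≤ 5|U| ≤ 6|U|.
      exponent : ∀ U S → Relevant U S → d * (3 + (∣ U ∣ + ∣ S ∣)) ≤ 3 * t U
      exponent U S (1≤u , σ≤u , _) = begin
        d * (3 + (∣ U ∣ + ∣ S ∣))          ≤⟨ ℕ.*-monoʳ-≤ d (ℕ.+-mono-≤ (ℕ.*-monoʳ-≤ 3 1≤u) (ℕ.+-monoʳ-≤ ∣ U ∣ σ≤u)) ⟩
        d * (3 * ∣ U ∣ + (∣ U ∣ + ∣ U ∣))  ≤⟨ ℕ.m≤m+n _ (d * ∣ U ∣) ⟩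
        d * (3 * ∣ U ∣ + (∣ U ∣ + ∣ U ∣)) + d * ∣ U ∣
          ≡⟨ solve 2 (λ d u → d :* (con 3 :* u :+ (u :+ u)) :+ d :* u := con 3 :* (con 2 :* d :* u)) refl d ∣ U ∣ ⟩
        3 * (2 * d * ∣ U ∣)                ≡⟨ cong (3 *_) (ℕ.m*n/n≡m (2 * d * ∣ U ∣) (8 * k)) ⟨
        3 * (2 * d * ∣ U ∣ * (8 * k) / (8 * k)) ≤⟨ ℕ.*-monoʳ-≤ 3 (ℕ./-monoˡ-≤ (8 * k) (begin
          2 * d * ∣ U ∣ * (8 * k)          ≡⟨ solve 3 (λ d u k → con 2 :* d :* u :* (con 8 :* k) := con 16 :* k :* d :* u) refl d ∣ U ∣ k ⟩
          16 * k * d * ∣ U ∣               ≤⟨ ℕ.*-monoˡ-≤ ∣ U ∣ 16kd≤s ⟩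
          s * ∣ U ∣                        ∎)) ⟩
        3 * t U                            ∎
        where
        open ℕ.≤-Reasoning
        open +-*-Solver

      -- The cut has at least 8kt = 2k · 4t edges, which gain a factor 2^(-4t). One t cancels the
      -- weight `a`; the other 3t pay for the power of `y`.
      weight : ∀ U S i → y ^ (3 + (∣ U ∣ + ∣ S ∣)) * (a ((U , S) , i) * Π ((U , S) , i)) ≤ suc q ^ m
      weight U S i = go (relevant? U S)
        where
        open ℕ.≤-Reasoning
        open +-*-Solver
        P = Π ((U , S) , i)
        go : (r : Dec (Relevant U S)) → y ^ (3 + (∣ U ∣ + ∣ S ∣)) * ((if does r then 2 ^ t U else 0) * P) ≤ suc q ^ m
        go (no _) = subst (_≤ suc q ^ m) (sym (ℕ.*-zeroʳ (y ^ (3 + (∣ U ∣ + ∣ S ∣))))) z≤n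
        go (yes rel@(_ , _ , su≤)) = begin
          y ^ (3 + (∣ U ∣ + ∣ S ∣)) * (2 ^ t U * P)  ≡⟨ cong (_* (2 ^ t U * P)) (ℕ.^-*-assoc 2 d _) ⟩
          2 ^ (d * (3 + (∣ U ∣ + ∣ S ∣))) * (2 ^ t U * P)  ≤⟨ ℕ.*-monoˡ-≤ _ (ℕ.^-monoʳ-≤ 2 (exponent U S rel)) ⟩
          2 ^ (3 * t U) * (2 ^ t U * P)              ≡⟨ ℕ.*-assoc (2 ^ (3 * t U)) _ P ⟨
          2 ^ (3 * t U) * 2 ^ t U * P                ≡⟨ cong (_* P) (ℕ.^-distribˡ-+-* 2 (3 * t U) (t U)) ⟨
          2 ^ (3 * t U + t U) * P                    ≤⟨ ∏-if-≤ (inCut? ((U , S) , i)) pairs (3 * t U + t U) 0<q (begin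
            suc q * (3 * t U + t U)                  ≡⟨ cong (_* (3 * t U + t U)) 1+q≡2k ⟩
            2 * k * (3 * t U + t U)                  ≡⟨ solve 2 (λ k t → con 2 :* k :* (con 3 :* t :+ t) := t :* (con 8 :* k)) refl k (t U) ⟩
            t U * (8 * k)                            ≤⟨ ℕ.m/n*n≤m (s * ∣ U ∣) (8 * k) ⟩
            s * ∣ U ∣                                ≤⟨ su≤ ⟩
            ∣E cut G U S ∣                           ∎) ⟩
          suc q ^ m                                  ∎

      -- Multiplying by y^(2n) turns the bound y^(−|U|−|S|) on the probability into y^(|∁ U| + |∁ S|),
      -- whose sum over all U and S is (1 + y)^(2n).
      weight′ : ∀ U S i → y ^ (3 + (n + n)) * (a ((U , S) , i) * Π ((U , S) , i)) ≤ suc q ^ m * (y ^ ∣ ∁ U ∣ * y ^ ∣ ∁ S ∣)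
      weight′ U S i = begin
        y ^ (3 + (n + n)) * W                      ≡⟨ cong (_* W) split ⟩
        y ^ (3 + (∣ U ∣ + ∣ S ∣)) * C * W          ≡⟨ solve 3 (λ a c w → a :* c :* w := a :* w :* c) refl (y ^ (3 + (∣ U ∣ + ∣ S ∣))) C W ⟩
        y ^ (3 + (∣ U ∣ + ∣ S ∣)) * W * C          ≤⟨ ℕ.*-monoˡ-≤ C (weight U S i) ⟩
        suc q ^ m * C                              ∎
        where
        open ℕ.≤-Reasoning
        open +-*-Solver
        W = a ((U , S) , i) * Π ((U , S) , i)
        C = y ^ ∣ ∁ U ∣ * y ^ ∣ ∁ S ∣
        split : y ^ (3 + (n + n)) ≡ y ^ (3 + (∣ U ∣ + ∣ S ∣)) * C
        split = trans (ℕ.^-distribˡ-+-* y 3 (n + n)) (trans (cong (y ^ 3 *_) (trans (ℕ.^-distribˡ-+-* y n n)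
            (sym (cong₂ _*_ (^-∣∁∣ U y) (^-∣∁∣ S y)))))
          (trans (solve 5 (λ p a a′ b b′ → p :* (a :* a′ :* (b :* b′)) := p :* (a :* b) :* (a′ :* b′)) refl
                   (y ^ 3) (y ^ ∣ U ∣) (y ^ ∣ ∁ U ∣) (y ^ ∣ S ∣) (y ^ ∣ ∁ S ∣))
            (cong (_* C) (sym (trans (ℕ.^-distribˡ-+-* y 3 (∣ U ∣ + ∣ S ∣)) (cong (y ^ 3 *_) (ℕ.^-distribˡ-+-* y ∣ U ∣ ∣ S ∣)))))))

      ∑-C : ∑ events (λ { ((U , S) , _) → suc q ^ m * (y ^ ∣ ∁ U ∣ * y ^ ∣ ∁ S ∣) }) ≡ suc q ^ m * (k * (suc y ^ n * suc y ^ n))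
      ∑-C = begin
        ∑ events (λ { ((U , S) , _) → Q * (y ^ ∣ ∁ U ∣ * y ^ ∣ ∁ S ∣) })
          ≡⟨ ∑-*ˡ Q _ events ⟩
        Q * ∑ events (λ { ((U , S) , _) → y ^ ∣ ∁ U ∣ * y ^ ∣ ∁ S ∣ })
          ≡⟨ cong (Q *_) (∑-cartesianProduct _ (cartesianProduct (subsets n) (subsets n)) (allFin k)) ⟩
        Q * ∑ (cartesianProduct (subsets n) (subsets n)) (λ (U , S) → ∑ (allFin k) (λ _ → y ^ ∣ ∁ U ∣ * y ^ ∣ ∁ S ∣))
          ≡⟨ cong (Q *_) (∑-cong (cartesianProduct (subsets n) (subsets n))
               (λ (U , S) → trans (∑-const (allFin k) _) (cong (_* (y ^ ∣ ∁ U ∣ * y ^ ∣ ∁ S ∣)) (List.length-tabulate {n = k} id)))) ⟩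
        Q * ∑ (cartesianProduct (subsets n) (subsets n)) (λ (U , S) → k * (y ^ ∣ ∁ U ∣ * y ^ ∣ ∁ S ∣))
          ≡⟨ cong (Q *_) (∑-*ˡ k _ (cartesianProduct (subsets n) (subsets n))) ⟩
        Q * (k * ∑ (cartesianProduct (subsets n) (subsets n)) (λ (U , S) → y ^ ∣ ∁ U ∣ * y ^ ∣ ∁ S ∣))
          ≡⟨ cong (λ z → Q * (k * z)) (trans (∑-cartesianProduct _ (subsets n) (subsets n))
               (trans (∑-cong (subsets n) (λ U → ∑-*ˡ (y ^ ∣ ∁ U ∣) _ (subsets n))) (∑-*ʳ _ _ (subsets n)))) ⟩
        Q * (k * (∑ (subsets n) (λ U → y ^ ∣ ∁ U ∣) * ∑ (subsets n) (λ S → y ^ ∣ ∁ S ∣)))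
          ≡⟨ cong (λ z → Q * (k * (z * z))) (∑-subsets n y) ⟩
        Q * (k * (suc y ^ n * suc y ^ n)) ∎
        where
        open ≡-Reasoning
        Q = suc q ^ m

      -- The three spare factors `y` absorb the k colours and, since (1 + y)^n ≤ (1 + n) y^n, one
      -- factor 1 + n ≤ y each for U and S.
      total : ∑ events (λ j → a j * Π j) < suc q ^ m
      total = ℕ.*-cancelˡ-< (y ^ (3 + (n + n))) _ _ (begin-strict
        y ^ (3 + (n + n)) * ∑ events (λ j → a j * Π j)          ≡⟨ ∑-*ˡ (y ^ (3 + (n + n))) _ events ⟨
        ∑ events (λ j → y ^ (3 + (n + n)) * (a j * Π j))        ≤⟨ ∑-mono events (λ { ((U , S) , i) → weight′ U S i }) ⟩
        ∑ events (λ { ((U , S) , _) → Q * (y ^ ∣ ∁ U ∣ * y ^ ∣ ∁ S ∣) }) ≡⟨ ∑-C ⟩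
        Q * (k * (suc y ^ n * suc y ^ n))                   ≤⟨ ℕ.*-monoʳ-≤ Q (ℕ.*-monoʳ-≤ k (ℕ.*-mono-≤ small small)) ⟩
        Q * (k * (y * y ^ n * (y * y ^ n)))                 <⟨ ℕ.*-monoʳ-< Q {{ℕ.m^n≢0 (suc q) m}} (ℕ.*-monoˡ-< _ {{ℕ.m*n≢0 _ _ {{y^1+n≢0}} {{y^1+n≢0}}}} k<2ᵈ) ⟩
        Q * (y * (y * y ^ n * (y * y ^ n)))                 ≡⟨ ℕ.*-comm Q _ ⟩
        y * (y * y ^ n * (y * y ^ n)) * Q                   ≡⟨ cong (_* Q) (solve 2 (λ y z → y :* (y :* z :* (y :* z)) := y :* (y :* (y :* con 1)) :* (z :* z)) refl y (y ^ n)) ⟩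
        y ^ 3 * (y ^ n * y ^ n) * Q                         ≡⟨ cong (λ z → y ^ 3 * z * Q) (ℕ.^-distribˡ-+-* y n n) ⟨
        y ^ 3 * y ^ (n + n) * Q                             ≡⟨ cong (_* Q) (ℕ.^-distribˡ-+-* y 3 (n + n)) ⟨
        y ^ (3 + (n + n)) * Q                               ∎)
        where
        open ℕ.≤-Reasoning
        open +-*-Solver
        Q = suc q ^ m
        small : suc y ^ n ≤ y * y ^ n
        small = ℕ.≤-trans ([1+y]^n≤[1+n]y^n n (ℕ.<⇒≤ n<2ᵈ)) (ℕ.*-monoˡ-≤ (y ^ n) n<2ᵈ)
        y^1+n≢0 : NonZero (y ^ suc n)
        y^1+n≢0 = ℕ.m^n≢0 y (suc n) {{ℕ.m^n≢0 2 d}}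

    colourful-exists : ∃[ c ] Colourful G c s
    colourful-exists = c , colourful
      where
      found = colouring-exists inCut? proj₂ (Product.≡-dec Fin._≟_ Fin._≟_) pairs! 1+q≡2k events a total
      c = proj₁ found

      colourful : Colourful G c s
      colourful U S i 1≤u σ≤u su≤ = begin-strict
        s * ∣ U ∣                           ≡⟨ ℕ.m≡m%n+[m/n]*n (s * ∣ U ∣) (8 * k) ⟩
        -- The rounding in `t` loses less than 8k, which the extra hit in `t<hits` makes up for.
        s * ∣ U ∣ % (8 * k) + t U * (8 * k)  <⟨ ℕ.+-monoˡ-< _ (ℕ.m%n<n (s * ∣ U ∣) (8 * k)) ⟩
        suc (t U) * (8 * k)                 ≤⟨ ℕ.*-monoˡ-≤ (8 * k) t<hits ⟩
        hits * (8 * k)                      ≡⟨ ℕ.*-comm hits (8 * k) ⟩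
        8 * k * hits                        ≤⟨ ℕ.*-monoʳ-≤ (8 * k) hits≤ ⟩
        8 * k * ∣E cut (colourClass G c i) U S ∣ ∎
        where
        open ℕ.≤-Reasoning
        j : Event
        j = (U , S) , i
        Hit? = hit? inCut? proj₂ c j
        hits = length (filter Hit? pairs)
        j∈events : j ∈ events
        j∈events = ∈.∈-cartesianProduct⁺ (∈.∈-cartesianProduct⁺ (∈-subsets U) (∈-subsets S)) (∈.∈-allFin i)
        a≡ : a j ≡ 2 ^ t U
        a≡ = cong (λ b → if b then 2 ^ t U else 0) (dec-true (relevant? U S) (1≤u , σ≤u , su≤))
        t<hits : t U < hits
        t<hits = ℕ.≰⇒> λ hits≤t → ℕ.<⇒≱ (subst (_< 2 ^ hits) a≡ (proj₂ found j∈events)) (ℕ.^-monoʳ-≤ 2 hits≤t)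
        hits≤ : hits ≤ ∣E cut (colourClass G c i) U S ∣
        hits≤ = Sublist.length-mono-≤ (Sublist.filter⁺ Hit? (edge? (cut (colourClass G c i) U S))
          (λ { refl ((u<v , g , sep) , i≡c) → u<v , (g , inj₁ (u<v , sym i≡c)) , sep }) (⊆-refl {x = pairs}))

-- Naturals as rationals.

ι-+ : ∀ m n → ι (m + n) ≡ ι m ℚ.+ ι n
ι-+ zero    n = sym (ℚ.+-identityˡ (ι n))
ι-+ (suc m) n = trans (ι-suc (m + n)) (trans (cong (1ℚ ℚ.+_) (ι-+ m n))
  (trans (sym (ℚ.+-assoc 1ℚ (ι m) (ι n))) (cong (ℚ._+ ι n) (sym (ι-suc m)))))

ι-* : ∀ m n → ι (m * n) ≡ ι m ℚ.* ι n
ι-* zero    n = sym (ℚ.*-zeroˡ (ι n))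
ι-* (suc m) n = trans (ι-+ n (m * n)) (trans (cong (ι n ℚ.+_) (ι-* m n))
  (trans (cong (ℚ._+ ι m ℚ.* ι n) (sym (ℚ.*-identityˡ (ι n))))
  (trans (sym (ℚ.*-distribʳ-+ (ι n) 1ℚ (ι m))) (cong (ℚ._* ι n) (sym (ι-suc m))))))

ι-mono-≤ : ∀ {m n} → m ≤ n → ι m ℚ.≤ ι n
ι-mono-≤ {m} {n} m≤n = subst₂ ℚ._≤_ (ℚ.+-identityʳ (ι m))
  (trans (sym (ι-+ m (n ∸ m))) (cong ι (ℕ.m+[n∸m]≡n m≤n))) (ℚ.+-monoʳ-≤ (ι m) (0≤ι (n ∸ m)))

ι-mono-< : ∀ {m n} → m < n → ι m ℚ.< ι n
ι-mono-< {m} m<n = ℚ.<-≤-trans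
  (subst (ι m ℚ.<_) (trans (ℚ.+-comm (ι m) 1ℚ) (sym (ι-suc m))) (p<p+q 0<1)) (ι-mono-≤ m<n)

ι-cancel-≤ : ∀ {m n} → ι m ℚ.≤ ι n → m ≤ n
ι-cancel-≤ ιm≤ιn = ℕ.≮⇒≥ λ n<m → ℚ.<-irrefl refl (ℚ.<-≤-trans (ι-mono-< n<m) ιm≤ιn)

ι-cancel-< : ∀ {m n} → ι m ℚ.< ι n → m < n
ι-cancel-< ιm<ιn = ℕ.≰⇒> λ n≤m → ℚ.<-irrefl refl (ℚ.<-≤-trans ιm<ιn (ι-mono-≤ n≤m))

-- Rational lower and upper bounds on reals.

0<½ : 0ℚ ℚ.< ½
0<½ = ℚ.positive⁻¹ ½

-- A rational strictly below log₂ n for every n ≥ 2; the value 1 fails at n = 2.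
⅞ : ℚ
⅞ = ℤ.+ 7 ℚ./ 8

0<⅞ : 0ℚ ℚ.< ⅞
0<⅞ = ℚ.positive⁻¹ ⅞

⅞≤1 : ⅞ ℚ.≤ 1ℚ
⅞≤1 = toWitness {a? = ⅞ ℚ.≤? 1ℚ} _

½*p<p : ∀ {p} → 0ℚ ℚ.< p → ½ ℚ.* p ℚ.< p
½*p<p {p} 0<p = subst (½ ℚ.* p ℚ.<_) (ℚ.*-identityˡ p) (*-monoˡ-< {p} {½} {1ℚ} 0<p (*<* (ℤ.+<+ (s≤s (s≤s z≤n)))))

0<½ι : ∀ m {{_ : NonZero m}} → 0ℚ ℚ.< ½ ℚ.* ι m
0<½ι m = 0<-* 0<½ (ι-mono-< (>-nonZero⁻¹ m))

below-half : ∀ m {{_ : NonZero m}} → Below (fromℕ m) (½ ℚ.* ι m)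
below-half m = ½*p<p (ι-mono-< (>-nonZero⁻¹ m))

-- The product cut asks for a strictly larger product of lower bounds; openness of `x` supplies one
-- by enlarging `a`.
below-* : ∀ {x y a b} → Below x a → 0ℚ ℚ.≤ a → Below y b → 0ℚ ℚ.< b → Below (x *ᴿ y) (a ℚ.* b)
below-* {x} {b = b} a<x 0≤a b<y 0<b =
  let (a′ , a<a′ , a′<x) = ℝ≥0.open′ x a<x
  in inj₂ (a′ , b , ℚ.≤-trans 0≤a (ℚ.<⇒≤ a<a′) , ℚ.<⇒≤ 0<b , a′<x , b<y , *-monoˡ-< 0<b a<a′)

below-/≤1 : ∀ {x y q} {{_ : Positive y}} → y ≤ᴿ fromℕ 1 → Below x q → Below (x /ᴿ y) q
below-/≤1 {x} {q = q} y≤1 q<x = 1ℚ , (λ 1<y → ℚ.<-irrefl refl (y≤1 1ℚ 1<y)) , subst (Below x) (sym (ℚ.*-identityʳ q)) q<x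

infix 4 _≤ᵁ_

-- A rational upper bound on a real, as a record so that `x` and `c` can be inferred from its type.
record _≤ᵁ_ (x : ℝ≥0) (c : ℚ) : Set where
  constructor bound
  field below⇒≤ : ∀ {q} → Below x q → q ℚ.≤ c

open _≤ᵁ_

fromℕ-≤ᵁ : ∀ m → fromℕ m ≤ᵁ ι m
fromℕ-≤ᵁ m = bound ℚ.<⇒≤

≤ᵁ-respʳ : ∀ {x c d} → c ≡ d → x ≤ᵁ c → x ≤ᵁ d
≤ᵁ-respʳ refl x≤c = x≤c

≤ᴿ-≤ᵁ-trans : ∀ {x y c} → x ≤ᴿ y → y ≤ᵁ c → x ≤ᵁ c
≤ᴿ-≤ᵁ-trans x≤y (bound y≤c) = bound λ {q} q<x → y≤c (x≤y q q<x)

*-≤ᵁ : ∀ {x y c d} → 0ℚ ℚ.≤ c → 0ℚ ℚ.≤ d → x ≤ᵁ c → y ≤ᵁ d → x *ᴿ y ≤ᵁ c ℚ.* d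
*-≤ᵁ 0≤c 0≤d (bound x≤c) (bound y≤d) = bound λ where
  (inj₁ q<0) → ℚ.≤-trans (ℚ.<⇒≤ q<0) (0≤-* 0≤c 0≤d)
  (inj₂ (a , b , 0≤a , 0≤b , a<x , b<y , q<ab)) →
    ℚ.≤-trans (ℚ.<⇒≤ q<ab) (*-mono-≤ 0≤b 0≤c (x≤c a<x) (y≤d b<y))

√-≤ᵁ : ∀ {x c d} → 0ℚ ℚ.≤ c → d ℚ.≤ c ℚ.* c → x ≤ᵁ d → √ x ≤ᵁ c
√-≤ᵁ {c = c} 0≤c d≤c² (bound x≤d) = bound λ where
  (inj₁ q<0)  → ℚ.≤-trans (ℚ.<⇒≤ q<0) 0≤c
  (inj₂ q²<x) → ℚ.≮⇒≥ λ c<q → ℚ.<-irrefl refl (ℚ.<-≤-trans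
    (ℚ.≤-<-trans (ℚ.*-monoˡ-≤-nonNeg c {{ℚ.nonNegative 0≤c}} (ℚ.<⇒≤ c<q)) (*-monoˡ-< (ℚ.≤-<-trans 0≤c c<q) c<q))
    (ℚ.≤-trans (x≤d q²<x) d≤c²))

/-≤ᵁ : ∀ {x y b c} {{_ : Positive y}} → 0ℚ ℚ.≤ c → 0ℚ ℚ.< b → Below y b → x ≤ᵁ c ℚ.* b → x /ᴿ y ≤ᵁ c
/-≤ᵁ {y = y} {b} {c} 0≤c 0<b b<y (bound x≤cb) = bound λ {q} (r , ¬r , qr<x) → ℚ.≮⇒≥ λ c<q → ℚ.<-irrefl refl
  (ℚ.<-≤-trans (*-monoˡ-< 0<b c<q) (ℚ.≤-trans
    (ℚ.*-monoˡ-≤-nonNeg q {{ℚ.nonNegative (ℚ.≤-trans 0≤c (ℚ.<⇒≤ c<q))}} (ℚ.<⇒≤ (Cut.separate y b<y ¬r)))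
    (x≤cb qr<x)))

/fromℕ-≤ᵁ : ∀ m {x c} {{_ : NonZero m}} → 0ℚ ℚ.≤ c → x ≤ᵁ c ℚ.* (½ ℚ.* ι m) → x /ᴿ fromℕ m ≤ᵁ c
/fromℕ-≤ᵁ m 0≤c = /-≤ᵁ {y = fromℕ m} 0≤c (0<½ι m) (below-half m)

below-half-* : ∀ m n {{_ : NonZero m}} {{_ : NonZero n}} → Below (fromℕ m *ᴿ fromℕ n) (½ ℚ.* ι m ℚ.* (½ ℚ.* ι n))
below-half-* m n = below-* {fromℕ m} {fromℕ n} (below-half m) (ℚ.<⇒≤ (0<½ι m)) (below-half n) (0<½ι n)

⅞<log₂ : ∀ {n} → 2 ≤ n → Below (log₂ n) ⅞
-- The claim unfolds to 2^7 < n^8.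
⅞<log₂ 2≤n = inj₂ (ℕ.<-≤-trans (toWitness {a? = 128 <? 256} _) (ℕ.^-monoˡ-≤ 8 2≤n))

/log₂-≤ᵁ : ∀ {n x c} → 2 ≤ n → 0ℚ ℚ.≤ c → x ≤ᵁ c ℚ.* ⅞ → x /log₂ n ≤ᵁ c
/log₂-≤ᵁ {1} (s≤s ())
/log₂-≤ᵁ {suc (suc n)} 2≤n 0≤c x≤ = /-≤ᵁ {y = log₂ (suc (suc n))} 0≤c 0<⅞ (⅞<log₂ 2≤n) x≤

fromℕ≤⇒≤ : ∀ {m x c} → fromℕ m ≤ᴿ x → x ≤ᵁ c → ι m ℚ.≤ c
fromℕ≤⇒≤ m≤x (bound x≤c) = ℚ.≮⇒≥ λ c<m → let (q , c<q , q<m) = ℚ.<-dense c<m in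
  ℚ.<-irrefl refl (ℚ.<-≤-trans c<q (x≤c (m≤x q q<m)))

*ᴿ-monoˡ : ∀ {x y} z → x ≤ᴿ y → x *ᴿ z ≤ᴿ y *ᴿ z
*ᴿ-monoˡ z x≤y q (inj₁ q<0) = inj₁ q<0
*ᴿ-monoˡ z x≤y q (inj₂ (a , b , 0≤a , 0≤b , a<x , rest)) = inj₂ (a , b , 0≤a , 0≤b , x≤y a a<x , rest)

/log₂-mono : ∀ n {x y} → x ≤ᴿ y → x /log₂ n ≤ᴿ y /log₂ n
/log₂-mono 0             x≤y q q<  = q<
/log₂-mono 1             x≤y q q<  = q<
/log₂-mono (suc (suc n)) x≤y q (r , ¬r , qr<x) = r , ¬r , x≤y (q ℚ.* r) qr<x

/fromℕ-≤ᴿ : ∀ {m x} {{_ : NonZero m}} → x /ᴿ fromℕ m ≤ᴿ x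
/fromℕ-≤ᴿ {m} {x} q (r , ¬r , qr<x) with 0∨pos q
... | inj₁ q<0 = ℝ≥0.negative x q<0
... | inj₂ 0≤q = Cut.lower≤ x (subst (ℚ._≤ q ℚ.* r) (ℚ.*-identityʳ q)
        (ℚ.*-monoˡ-≤-nonNeg q {{ℚ.nonNegative 0≤q}} (ℚ.≤-trans (ι-mono-≤ (>-nonZero⁻¹ m)) (ℚ.≮⇒≥ ¬r)))) qr<x


-- The lower bound on s in natural numbers.

2^l≤m<2^1+l : ∀ m {{_ : NonZero m}} → ∃[ l ] 2 ^ l ≤ m × m < 2 ^ suc l
2^l≤m<2^1+l 1             = 0 , ℕ.≤-refl , ℕ.≤-refl
2^l≤m<2^1+l (suc m@(suc _)) with 2^l≤m<2^1+l m
... | l , 2ˡ≤m , m<2ˡ⁺¹ with suc m <? 2 ^ suc l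
...   | yes 1+m<2ˡ⁺¹ = l , ℕ.m≤n⇒m≤1+n 2ˡ≤m , 1+m<2ˡ⁺¹
...   | no  1+m≮2ˡ⁺¹ = suc l , ℕ.≮⇒≥ 1+m≮2ˡ⁺¹ ,
  ℕ.≤-<-trans m<2ˡ⁺¹ (ℕ.m<m+n (2 ^ suc l) (ℕ.≤-trans (ℕ.m^n>0 2 (suc l)) (ℕ.m≤m+n _ 0)))

-- The factor 7/8 only matters for n = 2, where no positive integer is strictly below log₂ n.
log₂-approx : ∀ n → 2 ≤ n → ∃[ l ] ∃[ q ] 1 ≤ l × n < 2 ^ (l + 2) × ⅞ ℚ.* ι l ℚ.≤ q × Below (log₂ n) q
log₂-approx 1 (s≤s ())
-- The logarithm is rounded down at n - 1 rather than n, which gives the strict inequality 2^l < n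
-- that the cut demands.
log₂-approx (suc m@(suc _)) _ with 2^l≤m<2^1+l m
... | 0 , _ , s≤s (s≤s z≤n) = 1 , ⅞ , ℕ.≤-refl , toWitness {a? = 2 <? 8} _ , ℚ.≤-reflexive (ℚ.*-identityʳ ⅞) , inj₂ (toWitness {a? = 128 <? 256} _)
... | l@(suc _) , 2ˡ≤m , m<2ˡ⁺¹ = l , ι l , s≤s z≤n , n< , ⅞l≤l , inj₂ below
  where
  n< : suc m < 2 ^ (l + 2)
  n< = ℕ.≤-<-trans m<2ˡ⁺¹ (ℕ.^-monoʳ-< 2 ℕ.≤-refl (ℕ.≤-reflexive (ℕ.+-comm 2 l)))
  ⅞l≤l : ⅞ ℚ.* ι l ℚ.≤ ι l
  ⅞l≤l = subst (⅞ ℚ.* ι l ℚ.≤_) (ℚ.*-identityˡ (ι l)) (ℚ.*-monoʳ-≤-nonNeg (ι l) {{ℚ.nonNegative (0≤ι l)}} ⅞≤1)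
  below : 2 ^ ℤ.∣ ℚ.↥ ι l ∣ < suc m ^ ℚ.↧ₙ ι l
  below rewrite ι-mk l = subst (2 ^ l <_) (sym (ℕ.*-identityʳ (suc m))) (s≤s 2ˡ≤m)

-- Division by ε ≤ 1 can only help. One of the four logarithms is kept as `l`, the other three are
-- bounded below by 7/8.
s-lower-bound : ∀ n k s {{_ : NonZero k}} (ε : ℝ≥0) {{_ : Positive ε}} → 2 ≤ n → ε ≤ᴿ fromℕ 1 →
          fromℕ (2 ^ 12) /ᴿ ε *ᴿ fromℕ k ^ᴿ 2 *ᴿ log₂ n ^ᴿ 4 ≤ᴿ fromℕ s →
          ∃[ l ] 1 ≤ l × n < 2 ^ (l + 2) × 64 * (k * k * l) ≤ s
s-lower-bound n k s ε 2≤n ε≤1 hyp = l , 1≤l , n< , ι-cancel-≤ (begin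
  ι (64 * (k * k * l))               ≡⟨ trans (ι-* 64 (k * k * l)) (cong (ι 64 ℚ.*_) ι-kkl) ⟩
  ι 64 ℚ.* κ                         ≤⟨ ℚ.*-monoʳ-≤-nonNeg κ {{ℚ.nonNegative 0≤κ}} (toWitness {a? = ι 64 ℚ.≤? ℤ.+ 2401 ℚ./ 32} _) ⟩
  -- Here 2401/32 = 2^12 (7/8)^4 / 2^5. The five halvings come from 2^12, both factors k, and the
  -- `fromℕ 1` that ends each of the two powers.
  (ℤ.+ 2401 ℚ./ 32) ℚ.* κ            ≡⟨ solve 2 (λ k l → con (ℤ.+ 2401 ℚ./ 32) :* (k :* k :* l) :=
                                          con (½ ℚ.* ι 4096) :* (con ½ :* k :* (con ½ :* k :* con (½ ℚ.* ι 1))) :*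
                                          (con ⅞ :* l :* (con ⅞ :* (con ⅞ :* (con ⅞ :* con (½ ℚ.* ι 1)))))) refl (ι k) (ι l) ⟩
  A ℚ.* (⅞ ℚ.* ι l ℚ.* (⅞ ℚ.* (⅞ ℚ.* (⅞ ℚ.* h)))) ≤⟨ ℚ.*-monoˡ-≤-nonNeg A {{ℚ.nonNegative (ℚ.<⇒≤ 0<A)}} q⁴≥ ⟩
  A ℚ.* (q ℚ.* (q ℚ.* (q ℚ.* (q ℚ.* h))))    <⟨ hyp _ below ⟩
  ι s                                ∎)
  where
  open ℚ.≤-Reasoning
  open ℚ.+-*-Solver
  approx = log₂-approx n 2≤n
  l = proj₁ approx
  q = proj₁ (proj₂ approx)
  1≤l = proj₁ (proj₂ (proj₂ approx))
  n< = proj₁ (proj₂ (proj₂ (proj₂ approx)))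
  ⅞l≤q = proj₁ (proj₂ (proj₂ (proj₂ (proj₂ approx))))
  q<log = proj₂ (proj₂ (proj₂ (proj₂ (proj₂ approx))))
  h = ½ ℚ.* ι 1
  A = ½ ℚ.* ι 4096 ℚ.* (½ ℚ.* ι k ℚ.* (½ ℚ.* ι k ℚ.* h))
  κ = ι k ℚ.* ι k ℚ.* ι l
  ι-kkl : ι (k * k * l) ≡ κ
  ι-kkl = trans (ι-* (k * k) l) (cong (ℚ._* ι l) (ι-* k k))
  0≤κ : 0ℚ ℚ.≤ κ
  0≤κ = subst (0ℚ ℚ.≤_) ι-kkl (0≤ι (k * k * l))
  0<k : 0ℚ ℚ.< ½ ℚ.* ι k
  0<k = 0<-* 0<½ (ι-mono-< (>-nonZero⁻¹ k))
  0<h : 0ℚ ℚ.< h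
  0<h = ℚ.positive⁻¹ h
  0<e : 0ℚ ℚ.< ½ ℚ.* ι 4096
  0<e = ℚ.positive⁻¹ _
  ⅞≤q : ⅞ ℚ.≤ q
  ⅞≤q = ℚ.≤-trans (ℚ.*-monoˡ-≤-nonNeg ⅞ (ι-mono-≤ 1≤l)) ⅞l≤q
  0<q : 0ℚ ℚ.< q
  0<q = ℚ.<-≤-trans 0<⅞ ⅞≤q
  0<kkh = 0<-* 0<k (0<-* 0<k 0<h)
  0<A : 0ℚ ℚ.< A
  0<A = 0<-* 0<e 0<kkh
  0<qh = 0<-* 0<q 0<h
  0<qqh = 0<-* 0<q 0<qh
  0<qqqh = 0<-* 0<q 0<qqh
  ⅞· : ∀ {a b} → 0ℚ ℚ.< a → a ℚ.≤ b → ⅞ ℚ.* a ℚ.≤ q ℚ.* b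
  ⅞· 0<a a≤b = *-mono-≤ (ℚ.<⇒≤ 0<a) (ℚ.<⇒≤ 0<q) ⅞≤q a≤b
  q⁴≥ : ⅞ ℚ.* ι l ℚ.* (⅞ ℚ.* (⅞ ℚ.* (⅞ ℚ.* h))) ℚ.≤ q ℚ.* (q ℚ.* (q ℚ.* (q ℚ.* h)))
  q⁴≥ = *-mono-≤ (ℚ.<⇒≤ (ℚ.positive⁻¹ (⅞ ℚ.* (⅞ ℚ.* (⅞ ℚ.* h))))) (ℚ.<⇒≤ 0<q) ⅞l≤q
    (⅞· (ℚ.positive⁻¹ (⅞ ℚ.* (⅞ ℚ.* h))) (⅞· (ℚ.positive⁻¹ (⅞ ℚ.* h)) (⅞· 0<h ℚ.≤-refl)))
  below : Below (fromℕ (2 ^ 12) /ᴿ ε *ᴿ fromℕ k ^ᴿ 2 *ᴿ log₂ n ^ᴿ 4) (A ℚ.* (q ℚ.* (q ℚ.* (q ℚ.* (q ℚ.* h)))))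
  below = below-* {fromℕ (2 ^ 12) /ᴿ ε *ᴿ fromℕ k ^ᴿ 2} {log₂ n ^ᴿ 4}
    (below-* {fromℕ (2 ^ 12) /ᴿ ε} {fromℕ k ^ᴿ 2} (below-/≤1 {fromℕ (2 ^ 12)} {ε} ε≤1 (below-half (2 ^ 12))) (ℚ.<⇒≤ 0<e)
      (below-* {fromℕ k} {fromℕ k ^ᴿ 1} (below-half k) (ℚ.<⇒≤ 0<k) (below-* {fromℕ k} {fromℕ 1} (below-half k) (ℚ.<⇒≤ 0<k) (below-half 1) 0<h) (0<-* 0<k 0<h)) 0<kkh)
    (ℚ.<⇒≤ 0<A)
    (L 3 0<qqqh (L 2 0<qqh (L 1 0<qh (L 0 0<h (below-half 1)))))
    (0<-* 0<q 0<qqqh)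
    where
    L : ∀ i {b} → 0ℚ ℚ.< b → Below (log₂ n ^ᴿ i) b → Below (log₂ n ^ᴿ suc i) (q ℚ.* b)
    L i 0<b b< = below-* {log₂ n} {log₂ n ^ᴿ i} q<log (ℚ.<⇒≤ 0<q) b< 0<b

-- Rational bounds on the parameters of the colour classes.

-- The bound s′ ≤ s/(14k) on s′ = √(sε)/(8k)/log n comes from √(sε) ≤ s/8, 2k < 8k and 7/8 < log n.
⅛ ¹/₁₄ : ℚ
⅛    = ℤ.+ 1 ℚ./ 8
¹/₁₄ = ℤ.+ 1 ℚ./ 14

⅛-square : ∀ {s} → ι 64 ℚ.≤ s → s ℚ.* ι 1 ℚ.≤ ⅛ ℚ.* s ℚ.* (⅛ ℚ.* s)
⅛-square {s} 64≤s = begin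
  s ℚ.* ι 1                  ≡⟨ solve 1 (λ s → s :* con (ι 1) := con (⅛ ℚ.* ⅛) :* (con (ι 64) :* s)) refl s ⟩
  ⅛ ℚ.* ⅛ ℚ.* (ι 64 ℚ.* s)   ≤⟨ ℚ.*-monoˡ-≤-nonNeg (⅛ ℚ.* ⅛) (ℚ.*-monoʳ-≤-nonNeg s
                                  {{ℚ.nonNegative (ℚ.≤-trans (0≤ι 64) 64≤s)}} 64≤s) ⟩
  ⅛ ℚ.* ⅛ ℚ.* (s ℚ.* s)      ≡⟨ solve 1 (λ s → con (⅛ ℚ.* ⅛) :* (s :* s) := con ⅛ :* s :* (con ⅛ :* s)) refl s ⟩
  ⅛ ℚ.* s ℚ.* (⅛ ℚ.* s)      ∎
  where
  open ℚ.≤-Reasoning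
  open ℚ.+-*-Solver

-- The value c = s/(14k) is the one that makes s/8 equal to c · 7/8 · 2k.
rescale : ∀ c k s → c ℚ.* k ≡ ¹/₁₄ ℚ.* s → ⅛ ℚ.* s ≡ c ℚ.* ⅞ ℚ.* (½ ℚ.* ι 8 ℚ.* (½ ℚ.* k))
rescale c k s ck≡ = begin
  ⅛ ℚ.* s                                    ≡⟨ solve 1 (λ s → con ⅛ :* s := con 7/4 :* (con ¹/₁₄ :* s)) refl s ⟩
  7/4 ℚ.* (¹/₁₄ ℚ.* s)                       ≡⟨ cong (7/4 ℚ.*_) ck≡ ⟨
  7/4 ℚ.* (c ℚ.* k)                          ≡⟨ solve 2 (λ c k → con 7/4 :* (c :* k) :=
                                                  c :* con ⅞ :* (con (½ ℚ.* ι 8) :* (con ½ :* k))) refl c k ⟩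
  c ℚ.* ⅞ ℚ.* (½ ℚ.* ι 8 ℚ.* (½ ℚ.* k))      ∎
  where
  open ≡-Reasoning
  open ℚ.+-*-Solver
  7/4 = ℤ.+ 7 ℚ./ 4

8kcu≤su : ∀ c k s u → c ℚ.* k ≡ ¹/₁₄ ℚ.* s → 0ℚ ℚ.≤ s ℚ.* u → ι 8 ℚ.* k ℚ.* (c ℚ.* u) ℚ.≤ s ℚ.* u
8kcu≤su c k s u ck≡ 0≤su = begin
  ι 8 ℚ.* k ℚ.* (c ℚ.* u)            ≡⟨ solve 3 (λ k c u → con (ι 8) :* k :* (c :* u) := con (ι 8) :* (c :* k) :* u) refl k c u ⟩
  ι 8 ℚ.* (c ℚ.* k) ℚ.* u            ≡⟨ cong (λ z → ι 8 ℚ.* z ℚ.* u) ck≡ ⟩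
  ι 8 ℚ.* (¹/₁₄ ℚ.* s) ℚ.* u         ≡⟨ solve 2 (λ s u → con (ι 8) :* (con ¹/₁₄ :* s) :* u := con (ι 8 ℚ.* ¹/₁₄) :* (s :* u)) refl s u ⟩
  ι 8 ℚ.* ¹/₁₄ ℚ.* (s ℚ.* u)         ≤⟨ ℚ.*-monoʳ-≤-nonNeg (s ℚ.* u) {{ℚ.nonNegative 0≤su}} (toWitness {a? = ι 8 ℚ.* ¹/₁₄ ℚ.≤? 1ℚ} _) ⟩
  1ℚ ℚ.* (s ℚ.* u)                   ≡⟨ ℚ.*-identityˡ _ ⟩
  s ℚ.* u                            ∎
  where
  open ℚ.≤-Reasoning
  open ℚ.+-*-Solver

-- The denominator y stands for 8k.
module _ {n k s : ℕ} {{_ : NonZero k}} {ε y : ℝ≥0} {{_ : Positive y}} (2≤n : 2 ≤ n) (ε≤1 : ε ≤ᴿ fromℕ 1)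
         (64≤s : 64 ≤ s) (y> : Below y (½ ℚ.* ι 8 ℚ.* (½ ℚ.* ι k))) where

  private
    0<s : 0ℚ ℚ.< ι s
    0<s = ι-mono-< (ℕ.≤-trans (s≤s z≤n) 64≤s)

    0<k : 0ℚ ℚ.< ι k
    0<k = ι-mono-< (>-nonZero⁻¹ k)

  √sε-≤ᵁ : √ (fromℕ s *ᴿ ε) ≤ᵁ ⅛ ℚ.* ι s
  √sε-≤ᵁ = √-≤ᵁ (0≤-* (ℚ.<⇒≤ (ℚ.positive⁻¹ ⅛)) (ℚ.<⇒≤ 0<s)) (⅛-square (ι-mono-≤ 64≤s))
    (*-≤ᵁ (0≤ι s) (0≤ι 1) (fromℕ-≤ᵁ s) (≤ᴿ-≤ᵁ-trans ε≤1 (fromℕ-≤ᵁ 1)))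

  s′-≤ᵁ : ∀ c → c ℚ.* ι k ≡ ¹/₁₄ ℚ.* ι s → 0ℚ ℚ.≤ c → √ (fromℕ s *ᴿ ε) /ᴿ y /log₂ n ≤ᵁ c
  s′-≤ᵁ c ck≡ 0≤c = /log₂-≤ᵁ 2≤n 0≤c (/-≤ᵁ {y = y} (0≤-* 0≤c (ℚ.<⇒≤ 0<⅞)) (0<-* (0<½ι 8) (0<½ι k)) y>
    (≤ᵁ-respʳ (rescale c (ι k) (ι s) ck≡) √sε-≤ᵁ))

  deletion-bound : ∀ f u → fromℕ f ≤ᴿ √ (fromℕ s *ᴿ ε) /ᴿ y /log₂ n *ᴿ fromℕ u → 8 * k * f ≤ s * u
  deletion-bound f u f≤ = bounded (quotient (¹/₁₄ ℚ.* ι s) 0<k)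
    where
    bounded : ∃[ c ] c ℚ.* ι k ≡ ¹/₁₄ ℚ.* ι s → 8 * k * f ≤ s * u
    bounded (c , ck≡) = ι-cancel-≤ (begin
      ι (8 * k * f)                      ≡⟨ trans (ι-* (8 * k) f) (cong (ℚ._* ι f) (ι-* 8 k)) ⟩
      ι 8 ℚ.* ι k ℚ.* ι f                ≤⟨ ℚ.*-monoˡ-≤-nonNeg (ι 8 ℚ.* ι k) {{ℚ.nonNegative (0≤-* (0≤ι 8) (0≤ι k))}} f≤cu ⟩
      ι 8 ℚ.* ι k ℚ.* (c ℚ.* ι u)        ≤⟨ 8kcu≤su c (ι k) (ι s) (ι u) ck≡ (0≤-* (0≤ι s) (0≤ι u)) ⟩
      ι s ℚ.* ι u                        ≡⟨ ι-* s u ⟨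
      ι (s * u)                          ∎)
      where
      open ℚ.≤-Reasoning
      0≤c : 0ℚ ℚ.≤ c
      0≤c = ℚ.<⇒≤ (quotient-pos {r = c} (0<-* (ℚ.positive⁻¹ ¹/₁₄) 0<s) 0<k ck≡)
      f≤cu : ι f ℚ.≤ c ℚ.* ι u
      f≤cu = fromℕ≤⇒≤ {f} {√ (fromℕ s *ᴿ ε) /ᴿ y /log₂ n *ᴿ fromℕ u} f≤ (*-≤ᵁ 0≤c (0≤ι u) (s′-≤ᵁ c ck≡ 0≤c) (fromℕ-≤ᵁ u))

-- This supplies the hypothesis |S| ≤ |U| of `Colourful`. The crude bound ε/4 ≤ ½ suffices: two
-- divisions by log n > 7/8 give ½ (8/7)^2 = 32/49 < 1.
neighbourhood-bound : ∀ n u σ (ε : ℝ≥0) {q} → 2 ≤ n → ε ≤ᴿ fromℕ 1 →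
                      Below (ε /ᴿ fromℕ 4 *ᴿ fromℕ u /log₂ n /log₂ n) q → ι σ ℚ.≤ q → σ ≤ u
neighbourhood-bound n u σ ε {q} 2≤n ε≤1 q< σ≤q = ι-cancel-≤ (ℚ.≤-trans σ≤q (ℚ.≤-trans (below⇒≤ ε/4·u/log/log q<)
  (ℚ.≤-trans (ℚ.*-monoʳ-≤-nonNeg (ι u) {{ℚ.nonNegative (0≤ι u)}} (toWitness {a? = c₂ ℚ.≤? 1ℚ} _))
    (ℚ.≤-reflexive (ℚ.*-identityˡ (ι u))))))
  where
  c₁ = ℤ.+ 4 ℚ./ 7
  c₂ = ℤ.+ 32 ℚ./ 49
  open ℚ.+-*-Solver
  0≤ : ∀ c → 0ℚ ℚ.≤ c → 0ℚ ℚ.≤ c ℚ.* ι u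
  0≤ c 0≤c = 0≤-* 0≤c (0≤ι u)
  ε/4 : ε /ᴿ fromℕ 4 ≤ᵁ ½
  ε/4 = /fromℕ-≤ᵁ 4 (ℚ.<⇒≤ 0<½) (≤ᴿ-≤ᵁ-trans ε≤1 (fromℕ-≤ᵁ 1))
  ε/4·u : ε /ᴿ fromℕ 4 *ᴿ fromℕ u ≤ᵁ ½ ℚ.* ι u
  ε/4·u = *-≤ᵁ (ℚ.<⇒≤ 0<½) (0≤ι u) ε/4 (fromℕ-≤ᵁ u)
  ε/4·u/log : ε /ᴿ fromℕ 4 *ᴿ fromℕ u /log₂ n ≤ᵁ c₁ ℚ.* ι u
  ε/4·u/log = /log₂-≤ᵁ 2≤n (0≤ c₁ (ℚ.<⇒≤ (ℚ.positive⁻¹ c₁)))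
    (≤ᵁ-respʳ (solve 1 (λ u → con ½ :* u := con c₁ :* u :* con ⅞) refl (ι u)) ε/4·u)
  ε/4·u/log/log : ε /ᴿ fromℕ 4 *ᴿ fromℕ u /log₂ n /log₂ n ≤ᵁ c₂ ℚ.* ι u
  ε/4·u/log/log = /log₂-≤ᵁ 2≤n (0≤ c₂ (ℚ.<⇒≤ (ℚ.positive⁻¹ c₂)))
    (≤ᵁ-respʳ (solve 1 (λ u → con c₁ :* u := con c₂ :* u :* con ⅞) refl (ι u)) ε/4·u/log)

p-q<p : ∀ {p q} → 0ℚ ℚ.< q → p ℚ.- q ℚ.< p
p-q<p {p} {q} 0<q = subst (p ℚ.- q ℚ.<_) (ℚ.+-identityʳ p) (ℚ.+-monoʳ-< p (ℚ.neg-antimono-< 0<q))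

0≤p-q : ∀ {p q} → q ℚ.≤ p → 0ℚ ℚ.≤ p ℚ.- q
0≤p-q {p} {q} q≤p = subst (ℚ._≤ p ℚ.- q) (ℚ.+-inverseʳ q) (ℚ.+-monoˡ-≤ (ℚ.- q) q≤p)

-- For 0 ≤ p < ab the witnesses are a - δ and b - δ with δ(a + b) ≤ ab - p; the term δ² makes their
-- product exceed p, and δ ≤ 1 keeps them nonnegative.
fromℕ-*-≤ᴿ : ∀ {m} a b → m ≤ a * b → fromℕ m ≤ᴿ fromℕ a *ᴿ fromℕ b
fromℕ-*-≤ᴿ {m} a b m≤ab p p<m with 0∨pos p
... | inj₁ p<0 = inj₁ p<0
... | inj₂ 0≤p = inj₂ (ι a ℚ.- δ , ι b ℚ.- δ , 0≤p-q (ℚ.≤-trans δ≤1 (ι-mono-≤ 1≤a)) , 0≤p-q (ℚ.≤-trans δ≤1 (ι-mono-≤ 1≤b)) ,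
    p-q<p 0<δ , p-q<p 0<δ , (begin-strict
      p                                                  ≡⟨ solve 2 (λ p x → p := x :- (x :- p)) refl p (ι a ℚ.* ι b) ⟩
      ι a ℚ.* ι b ℚ.- (ι a ℚ.* ι b ℚ.- p)                ≤⟨ ℚ.+-monoʳ-≤ (ι a ℚ.* ι b) (ℚ.neg-antimono-≤ δS≤) ⟩
      ι a ℚ.* ι b ℚ.- δ ℚ.* (ι a ℚ.+ ι b)                <⟨ p<p+q (0<-* 0<δ 0<δ) ⟩
      ι a ℚ.* ι b ℚ.- δ ℚ.* (ι a ℚ.+ ι b) ℚ.+ δ ℚ.* δ    ≡⟨ solve 3 (λ a b d → a :* b :- d :* (a :+ b) :+ d :* d :=
                                                              (a :- d) :* (b :- d)) refl (ι a) (ι b) δ ⟩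
      (ι a ℚ.- δ) ℚ.* (ι b ℚ.- δ)                        ∎))
  where
  open ℚ.≤-Reasoning
  open ℚ.+-*-Solver
  1≤ab : 1 ≤ a * b
  1≤ab = ℕ.<-≤-trans (ι-cancel-< (ℚ.≤-<-trans 0≤p p<m)) m≤ab
  1≤a : 1 ≤ a
  1≤a = >-nonZero⁻¹ a {{ℕ.m*n≢0⇒m≢0 a {{>-nonZero 1≤ab}}}}
  1≤b : 1 ≤ b
  1≤b = >-nonZero⁻¹ b {{ℕ.m*n≢0⇒n≢0 a {{>-nonZero 1≤ab}}}}
  p<ab : p ℚ.< ι a ℚ.* ι b
  p<ab = subst (p ℚ.<_) (ι-* a b) (ℚ.<-≤-trans p<m (ι-mono-≤ m≤ab))
  shrunk = shrink (<-diff p<ab) (0<-+ (0≤ι a) (ι-mono-< 1≤b))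
  δ = proj₁ shrunk
  0<δ = proj₁ (proj₂ shrunk)
  δ≤1 = proj₁ (proj₂ (proj₂ shrunk))
  δS≤ = proj₂ (proj₂ (proj₂ shrunk))

-- Neighbourhoods after deleting edges, and cuts.

module _ {n : ℕ} (G : Graph n) (U : Subset n) where

  private
    IsNeighbour : Fin n → Set
    IsNeighbour v = v ∉ˢ U × ∃[ u ] u ∈ˢ U × Adj G u v

    isNeighbour? : ∀ v → Dec (IsNeighbour v)
    isNeighbour? v = ¬? (v Subset.∈? U) ×-dec Fin.any? λ u → (u Subset.∈? U) ×-dec adj? G u v

  ∈-N⁺ : ∀ {u v} → v ∉ˢ U → u ∈ˢ U → Adj G u v → v ∈ˢ N G U
  ∈-N⁺ {u} {v} v∉U u∈U uv = lookup⇒[]= v (N G U)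
    (trans (lookup∘tabulate _ v) (dec-true (isNeighbour? v) (v∉U , u , u∈U , uv)))

  ∈-N⁻ : ∀ {v} → v ∈ˢ N G U → v ∉ˢ U × ∃[ u ] u ∈ˢ U × Adj G u v
  ∈-N⁻ {v} v∈N = witness (isNeighbour? v) (trans (sym (lookup∘tabulate (λ v → does (isNeighbour? v)) v)) ([]=⇒lookup v∈N))
    where
    witness : ∀ {P : Set} (P? : Dec P) → does P? ≡ true → P
    witness (yes p) _ = p

module _ {n : ℕ} (G : Graph n) (U : Subset n) where

  -- An edge from U to a vertex outside U ∪ S lies in the deleted cut.
  N-∖-cut : ∀ S → N (G ∖ cut G U S) U ⊆ˢ S
  N-∖-cut S {v} v∈N with ∈-N⁻ (G ∖ cut G U S) U v∈N
  ... | v∉U , u , u∈U , uv , ¬cut = decidable-stable (v Subset.∈? S) λ v∉S → ¬cut (uv , inj₁ (u∈U , v∉U , v∉S))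

  -- An edge leaving U whose outer end is not a neighbour in `G ∖ F` must have been deleted.
  cut-N-∖ : ∀ F → cut G U (N (G ∖ F) U) ⊆ᴱ F
  cut-N-∖ F u v (uv , inj₁ sep) = oneWay uv sep
    where
    oneWay : ∀ {u v} → Adj G u v → Sep U (N (G ∖ F) U) u v → Adj F u v
    oneWay {u} {v} uv (u∈U , v∉U , v∉N) = decidable-stable (adj? F u v) λ ¬F → v∉N (∈-N⁺ (G ∖ F) U v∉U u∈U (uv , ¬F))
  cut-N-∖ F u v (uv , inj₂ (v∈U , u∉U , u∉N)) = decidable-stable (adj? F u v)
    λ ¬F → u∉N (∈-N⁺ (G ∖ F) U u∉U v∈U (Graph.symmetric G uv , λ f → ¬F (Graph.symmetric F f)))

-- Expansion of the colour classes.

module _ {n k s : ℕ} {{_ : NonZero n}} {{_ : NonZero k}} {ε : ℝ≥0} {{_ : Positive ε}} (ε≤1 : ε ≤ᴿ fromℕ 1)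
         (G : Graph n) (G-expands : IsExpander ε (fromℕ s) G) where

  -- Suppose |S| ≤ q for the remaining neighbourhood S. The cut of the colour class lies in `F`, so
  -- it is small, and by `Colourful` the cut of `G` has fewer than s|U| edges. Deleting it from `G`
  -- leaves U only neighbours in S, yet expansion of `G` yields more than q of them.
  colourful⇒expander : ∀ {c : Fin n × Fin n → Fin k} → Colourful G c s → 2 ≤ n → 64 ≤ s → ∀ i →
    IsExpander (ε /ᴿ fromℕ 4) (√ (fromℕ s *ᴿ ε) /ᴿ (fromℕ 8 *ᴿ fromℕ k) /log₂ n) (colourClass G c i)
  colourful⇒expander {c} colourful 2≤n 64≤s i U F _ 1≤u 3u≤2n F-few q q< =
    decidable-stable (q ℚ.<? ι ∣ S ∣) λ q≮N → ℚ.<-irrefl refl (ℚ.<-≤-trans (q<N′ (ℚ.≮⇒≥ q≮N))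
      (ℚ.≤-trans (ι-mono-≤ {∣ N (G ∖ cut G U S) U ∣} {∣ S ∣} (Subset.p⊆q⇒∣p∣≤∣q∣ (N-∖-cut G U S))) (ℚ.≮⇒≥ q≮N)))
    where
    H = colourClass G c i
    S = N (H ∖ F) U

    8k∣F∣≤su : 8 * k * ∣E F ∣ ≤ s * ∣ U ∣
    8k∣F∣≤su = deletion-bound {y = fromℕ 8 *ᴿ fromℕ k} {{*-positive {{fromℕ-positive}} {{fromℕ-positive}}}}
      2≤n ε≤1 64≤s (below-half-* 8 k) ∣E F ∣ ∣ U ∣ F-few

    cut-small : ι ∣ S ∣ ℚ.≤ q → ∣E cut G U S ∣ < s * ∣ U ∣
    cut-small σ≤q = ℕ.≰⇒> λ su≤ → ℕ.<⇒≱
      (colourful U S i 1≤u (neighbourhood-bound n ∣ U ∣ ∣ S ∣ ε 2≤n ε≤1 q< σ≤q) su≤)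
      (ℕ.≤-trans (ℕ.*-monoʳ-≤ (8 * k) (∣E∣-mono {F = cut H U S} {F} (cut-N-∖ H U F))) 8k∣F∣≤su)

    q<N′ : ι ∣ S ∣ ℚ.≤ q → q ℚ.< ι ∣ N (G ∖ cut G U S) U ∣
    q<N′ σ≤q = G-expands U (cut G U S) (λ _ _ → proj₁) 1≤u 3u≤2n
      (fromℕ-*-≤ᴿ s ∣ U ∣ (ℕ.<⇒≤ (cut-small σ≤q))) q
      -- The rational q lies below the bound for ε/4, hence below the one for ε.
      (/log₂-mono n (/log₂-mono n (*ᴿ-monoˡ {ε /ᴿ fromℕ 4} {ε} (fromℕ ∣ U ∣) (/fromℕ-≤ᴿ {4} {ε}))) q q<)

-- Small orders, the choice of d, and the final partition.

IsExpander-n<2 : ∀ {n} ε s (G : Graph n) → n < 2 → IsExpander ε s G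
-- A set U to test would give 3 ≤ 3|U| ≤ 2n ≤ 2.
IsExpander-n<2 _ _ _ n<2 U F _ 1≤u 3u≤2n = ⊥-elim (ℕ.<⇒≱ (ℕ.≤-<-trans (ℕ.*-monoʳ-≤ 2 (s≤s⁻¹ n<2)) ℕ.≤-refl)
  (ℕ.≤-trans (ℕ.*-monoʳ-≤ 3 1≤u) 3u≤2n))

-- For k, l ≥ 1 one has l + 2 + k ≤ 4kl. Shifting both variables by one leaves a difference with
-- nonnegative coefficients.
16k[l+2+k]≤s : ∀ {k l s} → 1 ≤ k → 1 ≤ l → 64 * (k * k * l) ≤ s → 16 * k * (l + 2 + k) ≤ s
16k[l+2+k]≤s {suc k} {suc l} (s≤s _) (s≤s _) = ℕ.≤-trans (ℕ.≤-trans (ℕ.m≤m+n _ (16 * suc k * (2 * k + l * (4 * k + 3) + k)))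
  (ℕ.≤-reflexive (solve 2 (λ k l → con 16 :* (con 1 :+ k) :* (con 1 :+ l :+ con 2 :+ (con 1 :+ k)) :+
      con 16 :* (con 1 :+ k) :* (con 2 :* k :+ l :* (con 4 :* k :+ con 3) :+ k) :=
    con 64 :* ((con 1 :+ k) :* (con 1 :+ k) :* (con 1 :+ l))) refl k l)))
  where open +-*-Solver

module _ (n k s : ℕ) {{n≢0 : NonZero n}} {{k≢0 : NonZero k}} {ε : ℝ≥0} {{ε>0 : Positive ε}} (ε≤1 : ε ≤ᴿ fromℕ 1)
         (G : Graph n) (G-expands : IsExpander ε (fromℕ s) G)
         (s-bound : fromℕ (2 ^ 12) /ᴿ ε *ᴿ fromℕ k ^ᴿ 2 *ᴿ log₂ n ^ᴿ 4 ≤ᴿ fromℕ s) where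

  private
    1≤k : 1 ≤ k
    1≤k = >-nonZero⁻¹ k

    ε′ s′ : ℝ≥0
    ε′ = ε /ᴿ fromℕ 4
    s′ = √ (fromℕ s *ᴿ ε) /ᴿ (fromℕ 8 *ᴿ fromℕ k) /log₂ n

    Expands : (Fin n × Fin n → Fin k) → Set₁
    Expands c = ∀ i → IsExpander ε′ s′ (colourClass G c i)

    c₀ : Fin n × Fin n → Fin k
    c₀ _ = Fin.fromℕ< 1≤k

    colouring : ∃[ l ] 1 ≤ l × n < 2 ^ (l + 2) × 64 * (k * k * l) ≤ s → ∃[ c ] Colourful G c s
    -- With d = l + 2 + k, the power 2^d exceeds both n and k.
    colouring (l , 1≤l , n<2^ , 64kkl≤s) = colourful-exists k s (l + 2 + k)
      (ℕ.<-≤-trans n<2^ (ℕ.^-monoʳ-≤ 2 (ℕ.m≤m+n (l + 2) k)))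
      (ℕ.<-≤-trans (LogLemmas.n<2^n 0 k) (ℕ.^-monoʳ-≤ 2 (ℕ.m≤n+m k (l + 2))))
      (16k[l+2+k]≤s 1≤k 1≤l 64kkl≤s) G

    64≤s : ∃[ l ] 1 ≤ l × n < 2 ^ (l + 2) × 64 * (k * k * l) ≤ s → 64 ≤ s
    64≤s (l , 1≤l , _ , 64kkl≤s) =
      ℕ.≤-trans (ℕ.*-monoʳ-≤ 64 (ℕ.*-mono-≤ (ℕ.*-mono-≤ 1≤k 1≤k) 1≤l)) 64kkl≤s

    expanding : 2 ≤ n → 64 ≤ s → ∃[ c ] Colourful G c s → ∃[ c ] Expands c
    expanding 2≤n 64≤s (c , colourful) =
      c , colourful⇒expander {n} {k} {s} {{n≢0}} {{k≢0}} {ε} {{ε>0}} ε≤1 G G-expands {c} colourful 2≤n 64≤s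

    byOrder : Dec (2 ≤ n) → ∃[ c ] Expands c
    byOrder (no n≱2)  = c₀ , λ i → IsExpander-n<2 ε′ s′ (colourClass G c₀ i) (ℕ.≰⇒> n≱2)
    byOrder (yes 2≤n) = expanding 2≤n (64≤s large) (colouring large)
      where
      large : ∃[ l ] 1 ≤ l × n < 2 ^ (l + 2) × 64 * (k * k * l) ≤ s
      large = s-lower-bound n k s ε 2≤n ε≤1 s-bound

  expander-colouring : ∃[ c ] Expands c
  expander-colouring = byOrder (2 ≤? n)

lemma15 : ∀ (n k s : ℕ) {{_ : NonZero n}} {{_ : NonZero k}}
    (ε : ℝ≥0) {{_ : Positive ε}} → ε ≤ᴿ fromℕ 1 →
    (G : Graph n) → IsExpander ε (fromℕ s) G →
    fromℕ (2 ^ 12) /ᴿ ε *ᴿ fromℕ k ^ᴿ 2 *ᴿ log₂ n ^ᴿ 4 ≤ᴿ fromℕ s →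
    Σ[ H ∈ (Fin k → Graph n) ]
    EdgeDisjoint H × IsEdgeUnion G H ×
    (∀ i → IsExpander (ε /ᴿ fromℕ 4)
    (√ (fromℕ s *ᴿ ε) /ᴿ (fromℕ 8 *ᴿ fromℕ k) /log₂ n)
    (H i))
lemma15 n k s {{n≢0}} {{k≢0}} ε {{ε>0}} ε≤1 G G-expands s-bound =
  partition (expander-colouring n k s {{n≢0}} {{k≢0}} {ε} {{ε>0}} ε≤1 G G-expands s-bound)
  where
  partition : _ → _
  partition (c , expands) = colourClass G c , colourClass-disjoint G c , colourClass-union G c , expands
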